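{- Let $B\ge 1$, $C\ge 1$ and $k$ be integers with $2\le k\le CB$ and $B\mid k$, and let $p_1,\ldots,p_k\ge 0$ with $\sum_i p_i=1$. The expected number of cache misses in $n$ rounds of the sequence-access process (defined in the context) on an initially empty direct-mapped cache with $C$ blocks of $B$ words is at most $$k+n\left(\frac1B+\frac{k(B-1)}{B^2C}+\frac{(B-1)^2}{B^2C}\sum_{i=1}^k\sum_{j=1}^k\frac{p_ip_j}{p_i+p_j}\right).$$
   Context: Cache model: memory words are indexed by non-negative integers and partitioned into blocks of $B$ consecutive words starting at multiples of $B$. A direct-mapped cache has $C$ cache blocks; word $x$ can only reside in cache block $\lfloor x/B\rfloor \bmod C$. An access to $x$ is a hit if that cache block currently holds the memory block of $x$; otherwise it is a miss and the memory block of $x$ is loaded into that cache block, evicting its previous contents. The cache is initially empty. Sequence-access process: there are $k$ pointers $D_1,\ldots,D_k$. Each round: (1) pick $x\in\{1,\ldots,k\}$ with $\Pr[x=i]=p_i$, independently of all previous picks; (2) access the location pointed to by $D_x$, then increment $D_x$ by 1. Let $d_{i,1},d_{i,2},\ldots$ be the locations accessed via $D_i$. Assumptions: (a) each $d_{i,1}\bmod BC$ is uniform over $\{0,\ldots,BC-1\}$, independently over $i$; (b) the pointers traverse sequences of memory locations disjoint from each other; (d) the pointers $D_1,\ldots,D_k$ are in separate memory blocks. Expectations are over the random picks and starting positions.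
   Formalization: The probabilities p_1,…,p_k are taken to be rational numbers instead of real numbers (with p_i p_j/(p_i+p_j) read as 0 when p_i = p_j = 0). -}

module Defs where

open import Data.Nat as ℕ using (ℕ; zero; suc; NonZero; _/_; _%_)
open import Data.Fin using (Fin; zero; suc; toℕ)
open import Data.Maybe using (Maybe; just; nothing)
open import Data.Product using (_×_; _,_)
open import Data.Integer using (+_)
open import Data.Rational as ℚ using (ℚ; 0ℚ; 1ℚ; _+_; _*_; _÷_; ≢-nonZero)
open import Data.Rational.Properties using (_≟_)
open import Relation.Nullary using (yes; no)

ℕ→ℚ : ℕ → ℚ
ℕ→ℚ n = (+ n) ℚ./ 1

-- total division on ℚ (x / 0 := 0); only used with nonzero denominators,
-- except for the convention p_i p_j / (p_i + p_j) := 0 when p_i = p_j = 0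
_÷₀_ : ℚ → ℚ → ℚ
x ÷₀ y with y ≟ 0ℚ
... | yes _ = 0ℚ
... | no y≢0 = _÷_ x y {{≢-nonZero y≢0}}

sumFin : (n : ℕ) → (Fin n → ℚ) → ℚ
sumFin zero f = 0ℚ
sumFin (suc n) f = f zero + sumFin n (λ i → f (suc i))

consF : ∀ {k} {A : Set} → A → (Fin k → A) → Fin (suc k) → A
consF a g zero = a
consF a g (suc i) = g i

sumFuns : (k m : ℕ) → ((Fin k → Fin m) → ℚ) → ℚ
sumFuns zero m F = F (λ ())
sumFuns (suc k) m F = sumFin m (λ a → sumFuns k m (λ g → F (consF a g)))

updF : ∀ {k} {A : Set} → (Fin k → A) → Fin k → A → Fin k → A
updF f zero a zero = a
updF f zero a (suc j) = f (suc j)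
updF f (suc i) a zero = f zero
updF f (suc i) a (suc j) = updF (λ l → f (suc l)) i a j

updℕ : {A : Set} → (ℕ → A) → ℕ → A → ℕ → A
updℕ f i a j with i ℕ.≟ j
... | yes _ = a
... | no _ = f j

-- direct-mapped cache: cache block index ↦ memory block number held (or empty)
Cache : Set
Cache = ℕ → Maybe ℕ

emptyCache : Cache
emptyCache _ = nothing

access : (B C : ℕ) → .{{NonZero B}} → .{{NonZero C}} → Cache → ℕ → ℕ × Cache
access B C cache a with cache ((a / B) % C)
... | nothing = 1 , updℕ cache ((a / B) % C) (just (a / B))
... | just b with b ℕ.≟ (a / B)
...   | yes _ = 0 , cache
...   | no _ = 1 , updℕ cache ((a / B) % C) (just (a / B))

-- Expected number of misses in n further rounds of the sequence-access process,
-- from cache state `cache`, where pointer D_i currently points to base i + pos i.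
-- Each round picks x with probability p x, accesses D_x and increments D_x.
expMisses : (B C k : ℕ) → .{{NonZero B}} → .{{NonZero C}} →
            (p : Fin k → ℚ) → (base : Fin k → ℕ) →
            ℕ → Cache → (Fin k → ℕ) → ℚ
expMisses B C k p base zero cache pos = 0ℚ
expMisses B C k p base (suc n) cache pos =
  sumFin k (λ x → p x * step x (access B C cache (base x ℕ.+ pos x)) )
  where
  step : Fin k → ℕ × Cache → ℚ
  step x (m , cache') = ℕ→ℚ m + expMisses B C k p base n cache' (updF pos x (suc (pos x)))

-- Expected number of misses in n rounds from an empty cache, where the starting
-- address of pointer i is  d_{i,1} = B*C * h s i + s i,  the residues
-- s : Fin k → Fin (B*C) being uniform and independent over i, and the high
-- parts h s i arbitrary (possibly depending on s).
startAddr : (B C k : ℕ) → (h : (Fin k → Fin (B ℕ.* C)) → Fin k → ℕ) →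
            (Fin k → Fin (B ℕ.* C)) → Fin k → ℕ
startAddr B C k h s i = B ℕ.* C ℕ.* h s i ℕ.+ toℕ (s i)

expectedMisses : (B C k : ℕ) → .{{NonZero B}} → .{{NonZero C}} →
                 (p : Fin k → ℚ) → (h : (Fin k → Fin (B ℕ.* C)) → Fin k → ℕ) → ℕ → ℚ
expectedMisses B C k p h n =
  sumFuns k (B ℕ.* C) (λ s → expMisses B C k p (startAddr B C k h s) n emptyCache (λ _ → 0))
    ÷₀ ℕ→ℚ ((B ℕ.* C) ℕ.^ k)

bound : (B C k : ℕ) → (p : Fin k → ℚ) → ℕ → ℚ
bound B C k p n =
  ℕ→ℚ k + ℕ→ℚ n * ( (1ℚ ÷₀ ℕ→ℚ B)
                  + (ℕ→ℚ (k ℕ.* (B ℕ.∸ 1)) ÷₀ ℕ→ℚ (B ℕ.* B ℕ.* C))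
                  + (ℕ→ℚ ((B ℕ.∸ 1) ℕ.* (B ℕ.∸ 1)) ÷₀ ℕ→ℚ (B ℕ.* B ℕ.* C))
                    * sumFin k (λ i → sumFin k (λ j → (p i * p j) ÷₀ (p i + p j))) )

{-# OPTIONS --safe #-}
-- A miss of D_i at word a, other than its first access, happens at the start of a memory block
-- (probability 1/B by uniformity of the start) or inside a block that some D_j has evicted since
-- the last pick of i. If D_j was picked m ≥ 1 times since then, it met the cache block of a for at
-- most B − 1 + m of the B C equally likely starts of D_j. So for each fixed sequence of picks the
-- average over the starts is bounded by a cost that depends only on the numbers m, and what
-- remains is, for each pair (i, j), the Markov chain m ↦ 0 (pick of i), m ↦ m + 1 (pick of j).
-- Its expected cost per round is at most p_j (β p_i / (p_i + p_j) + 1), β = B − 1, as certified by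
-- the potential equal to 0 at m = 0 and to β p_i / (p_i + p_j) + m at m ≥ 1. Since Σ p_j = 1, these
-- rates add up to β Σ p_i p_j / (p_i + p_j) + k.
module Submission where

open import Defs
open import Data.Nat as ℕ using (ℕ; zero; suc; NonZero; _/_; _%_)
import Data.Nat.Properties as ℕ
open import Data.Nat.DivMod
  using (m≡m%n+[m/n]*n; m<n⇒m%n≡m; m%n<n; m*n%n≡0; m<n⇒m/n≡0; m*n/n≡m; +-distrib-/-∣ˡ; +-distrib-/-∣ʳ; %-remove-+ˡ)
open import Data.Nat.Divisibility using (_∣_; ∣-trans; m∣m*n; n∣m*n)
open import Data.Fin as Fin using (Fin; zero; suc; toℕ; fromℕ<)
open import Data.Fin.Properties using (toℕ-fromℕ<; toℕ<n; toℕ-injective)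
import Data.Integer as ℤ
import Data.Integer.Properties as ℤ
open import Data.List using (List; []; _∷_)
open import Data.Maybe using (just; nothing)
open import Data.Maybe.Properties using (just-injective)
open import Data.Product using (_,_; proj₁; proj₂; ∃)
open import Data.Sum using (_⊎_; inj₁; inj₂)
open import Data.Rational as ℚ using (ℚ; 0ℚ; 1ℚ; _+_; _*_; _-_; _≤_; nonNegative)
open import Data.Rational.Properties hiding (_≟_)
import Data.Rational.Properties as ℚ
import Data.Rational.Unnormalised as ℚᵘ
import Data.Rational.Unnormalised.Properties as ℚᵘ
open import Data.Rational.Solver using (module +-*-Solver)
open import Algebra.Properties.Group +-0-group using (∙-cancelˡ)
open import Data.Empty using (⊥-elim)
open import Function using (_∘_)
open import Relation.Nullary using (Dec; yes; no; ¬_)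
open import Relation.Binary.PropositionalEquality
  using (_≡_; _≢_; refl; sym; trans; cong; cong₂; subst; subst₂; module ≡-Reasoning)

open +-*-Solver using (solve; _:=_; _:+_; _:*_; _:-_; con)

-- Rational arithmetic: order, naturals, total division, indicators

*-mono-nonNeg : ∀ {a b c} → 0ℚ ≤ a → b ≤ c → a * b ≤ a * c
*-mono-nonNeg {a} 0≤a = *-monoˡ-≤-nonNeg a {{nonNegative 0≤a}}

+-nonNeg : ∀ {a b} → 0ℚ ≤ a → 0ℚ ≤ b → 0ℚ ≤ a + b
+-nonNeg 0≤a 0≤b = +-mono-≤ 0≤a 0≤b

*-nonNeg : ∀ {a b} → 0ℚ ≤ a → 0ℚ ≤ b → 0ℚ ≤ a * b
*-nonNeg {a} {b} 0≤a 0≤b = subst (_≤ a * b) (*-zeroʳ a) (*-mono-nonNeg 0≤a 0≤b)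

≤-+-nonNegʳ : ∀ {a b} → 0ℚ ≤ b → a ≤ a + b
≤-+-nonNegʳ {a} {b} 0≤b = subst (_≤ a + b) (+-identityʳ a) (+-monoʳ-≤ a 0≤b)

≤-+-nonNegˡ : ∀ {a b} → 0ℚ ≤ b → a ≤ b + a
≤-+-nonNegˡ {a} {b} 0≤b = subst (_≤ b + a) (+-identityˡ a) (+-monoˡ-≤ a 0≤b)

0≤1 : 0ℚ ≤ 1ℚ
0≤1 = nonNegative⁻¹ 1ℚ

-- The denominator stays literally 1 here, so sums and products of naturals become integer
-- identities, free of the normalisation in `ℚ`.
ℕ→ℚᵘ : ℕ → ℚᵘ.ℚᵘ
ℕ→ℚᵘ n = ℚᵘ.mkℚᵘ (ℤ.+ n) 0

toℚᵘ-ℕ→ℚ : ∀ n → ℚ.toℚᵘ (ℕ→ℚ n) ℚᵘ.≃ ℕ→ℚᵘ n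
toℚᵘ-ℕ→ℚ n = toℚᵘ-fromℚᵘ (ℕ→ℚᵘ n)

ℕ→ℚ-+ : ∀ m n → ℕ→ℚ (m ℕ.+ n) ≡ ℕ→ℚ m + ℕ→ℚ n
ℕ→ℚ-+ m n = toℚᵘ-injective (begin
  ℚ.toℚᵘ (ℕ→ℚ (m ℕ.+ n))                ≈⟨ toℚᵘ-ℕ→ℚ (m ℕ.+ n) ⟩
  ℕ→ℚᵘ (m ℕ.+ n)                        ≈⟨ ℚᵘ.*≡* (cong (ℤ._* ℤ.+ 1) (cong₂ ℤ._+_ (sym (ℤ.*-identityʳ (ℤ.+ m))) (sym (ℤ.*-identityʳ (ℤ.+ n))))) ⟩
  ℕ→ℚᵘ m ℚᵘ.+ ℕ→ℚᵘ n                    ≈⟨ ℚᵘ.+-cong (toℚᵘ-ℕ→ℚ m) (toℚᵘ-ℕ→ℚ n) ⟨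
  ℚ.toℚᵘ (ℕ→ℚ m) ℚᵘ.+ ℚ.toℚᵘ (ℕ→ℚ n)    ≈⟨ toℚᵘ-homo-+ (ℕ→ℚ m) (ℕ→ℚ n) ⟨
  ℚ.toℚᵘ (ℕ→ℚ m + ℕ→ℚ n)                ∎)
  where open ℚᵘ.≃-Reasoning

ℕ→ℚ-* : ∀ m n → ℕ→ℚ (m ℕ.* n) ≡ ℕ→ℚ m * ℕ→ℚ n
ℕ→ℚ-* m n = toℚᵘ-injective (begin
  ℚ.toℚᵘ (ℕ→ℚ (m ℕ.* n))                ≈⟨ toℚᵘ-ℕ→ℚ (m ℕ.* n) ⟩
  ℕ→ℚᵘ (m ℕ.* n)                        ≈⟨ ℚᵘ.*≡* (cong (ℤ._* ℤ.+ 1) (ℤ.pos-* m n)) ⟩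
  ℕ→ℚᵘ m ℚᵘ.* ℕ→ℚᵘ n                    ≈⟨ ℚᵘ.*-cong (toℚᵘ-ℕ→ℚ m) (toℚᵘ-ℕ→ℚ n) ⟨
  ℚ.toℚᵘ (ℕ→ℚ m) ℚᵘ.* ℚ.toℚᵘ (ℕ→ℚ n)    ≈⟨ toℚᵘ-homo-* (ℕ→ℚ m) (ℕ→ℚ n) ⟨
  ℚ.toℚᵘ (ℕ→ℚ m * ℕ→ℚ n)                ∎)
  where open ℚᵘ.≃-Reasoning

ℕ→ℚ-suc : ∀ n → ℕ→ℚ (suc n) ≡ 1ℚ + ℕ→ℚ n
ℕ→ℚ-suc = ℕ→ℚ-+ 1

0≤ℕ→ℚ : ∀ n → 0ℚ ≤ ℕ→ℚ n
0≤ℕ→ℚ zero    = ≤-refl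
0≤ℕ→ℚ (suc n) = subst (0ℚ ≤_) (sym (ℕ→ℚ-suc n)) (+-nonNeg 0≤1 (0≤ℕ→ℚ n))

ℕ→ℚ-nonZero : ∀ n → .{{NonZero n}} → ℕ→ℚ n ≢ 0ℚ
ℕ→ℚ-nonZero (suc n) n≡0 = <⇒≢ (positive⁻¹ 1ℚ) (≤-antisym 0≤1
  (subst (1ℚ ≤_) (trans (sym (ℕ→ℚ-suc n)) n≡0) (≤-+-nonNegʳ (0≤ℕ→ℚ n))))

inv : ℚ → ℚ
inv y = 1ℚ ÷₀ y

-- At `y ≡ 0ℚ` both sides are 0 by convention. Quotients thus become products that the ring solver
-- can handle.
÷₀≡*inv : ∀ x y → x ÷₀ y ≡ x * inv y
÷₀≡*inv x y with y ℚ.≟ 0ℚ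
... | yes _ = sym (*-zeroʳ x)
... | no y≢0 = cong (x *_) (sym (*-identityˡ _))

inv-inverseʳ : ∀ y → y ≢ 0ℚ → y * inv y ≡ 1ℚ
inv-inverseʳ y y≢0 with y ℚ.≟ 0ℚ
... | yes y≡0 = ⊥-elim (y≢0 y≡0)
... | no y≢0′ = trans (cong (y *_) (*-identityˡ _)) (*-inverseʳ y {{ℚ.≢-nonZero y≢0′}})

0≤inv : ∀ y → 0ℚ ≤ y → 0ℚ ≤ inv y
0≤inv y 0≤y with y ℚ.≟ 0ℚ
... | yes _ = ≤-refl
... | no y≢0 = subst (0ℚ ≤_) (sym (*-identityˡ 1/y)) (<⇒≤ (positive⁻¹ 1/y {{1/pos⇒pos y {{y-positive}}}}))
  where
  1/y = (ℚ.1/ y) {{ℚ.≢-nonZero y≢0}}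
  y-positive = nonNeg∧nonZero⇒pos y {{nonNegative 0≤y}} {{ℚ.≢-nonZero y≢0}}

*-cancelˡ-≡ : ∀ z {x y} → z ≢ 0ℚ → z * x ≡ z * y → x ≡ y
*-cancelˡ-≡ z {x} {y} z≢0 zx≡zy = begin
  x                ≡⟨ undo x ⟨
  inv z * (z * x)  ≡⟨ cong (inv z *_) zx≡zy ⟩
  inv z * (z * y)  ≡⟨ undo y ⟩
  y                ∎
  where
  open ≡-Reasoning
  undo : ∀ x → inv z * (z * x) ≡ x
  undo x = trans (sym (*-assoc (inv z) z x))
    (trans (cong (_* x) (trans (*-comm (inv z) z) (inv-inverseʳ z z≢0))) (*-identityˡ x))

𝟙 : {P : Set} → Dec P → ℚ
𝟙 (yes _) = 1ℚ
𝟙 (no _)  = 0ℚ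

module _ {P : Set} where

  0≤𝟙 : (P? : Dec P) → 0ℚ ≤ 𝟙 P?
  0≤𝟙 (yes _) = 0≤1
  0≤𝟙 (no _)  = ≤-refl

  𝟙-true : (P? : Dec P) → P → 𝟙 P? ≡ 1ℚ
  𝟙-true (yes _) _ = refl
  𝟙-true (no ¬p) p = ⊥-elim (¬p p)

  𝟙-false : (P? : Dec P) → ¬ P → 𝟙 P? ≡ 0ℚ
  𝟙-false (yes p) ¬p = ⊥-elim (¬p p)
  𝟙-false (no _)  _  = refl

𝟙-cong : {P Q : Set} → (P → Q) → (Q → P) → (P? : Dec P) (Q? : Dec Q) → 𝟙 P? ≡ 𝟙 Q?
𝟙-cong f g (yes p) Q? = sym (𝟙-true Q? (f p))
𝟙-cong f g (no ¬p) Q? = sym (𝟙-false Q? (¬p ∘ g))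

-- Finite sums

-- Covers both `sumFin` and `sumFuns`, so that one exchange argument serves sums over pointers,
-- residues and starts.
record Linear {I : Set} (S : (I → ℚ) → ℚ) : Set where
  field
    S-cong : ∀ {f g} → (∀ i → f i ≡ g i) → S f ≡ S g
    S-+    : ∀ f g → S (λ i → f i + g i) ≡ S f + S g
    S-*    : ∀ r f → S (λ i → r * f i) ≡ r * S f

  S-0 : S (λ _ → 0ℚ) ≡ 0ℚ
  S-0 = trans (S-* 0ℚ (λ _ → 0ℚ)) (*-zeroˡ (S (λ _ → 0ℚ)))

  S-sumFin : ∀ k (f : I → Fin k → ℚ) → S (λ i → sumFin k (f i)) ≡ sumFin k (λ x → S (λ i → f i x))
  S-sumFin zero    f = S-0
  S-sumFin (suc k) f = trans (S-+ _ _) (cong (S (λ i → f i zero) +_) (S-sumFin k _))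

  S-*ʳ : ∀ r f → S (λ i → f i * r) ≡ S f * r
  S-*ʳ r f = trans (S-cong (λ i → *-comm (f i) r)) (trans (S-* r f) (*-comm r (S f)))

open Linear

sumFin-cong : ∀ k {f g : Fin k → ℚ} → (∀ i → f i ≡ g i) → sumFin k f ≡ sumFin k g
sumFin-cong zero    f≡g = refl
sumFin-cong (suc k) f≡g = cong₂ _+_ (f≡g zero) (sumFin-cong k (f≡g ∘ suc))

+-interchange : ∀ a b c d → (a + b) + (c + d) ≡ (a + c) + (b + d)
+-interchange = solve 4 (λ a b c d → (a :+ b) :+ (c :+ d) := (a :+ c) :+ (b :+ d)) refl

sumFin-linear : ∀ k → Linear (sumFin k)
sumFin-linear k .S-cong = sumFin-cong k
sumFin-linear zero .S-+ f g = refl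
sumFin-linear (suc k) .S-+ f g = trans
  (cong (f zero + g zero +_) (sumFin-linear k .S-+ (f ∘ suc) (g ∘ suc)))
  (+-interchange (f zero) (g zero) (sumFin k (f ∘ suc)) (sumFin k (g ∘ suc)))
sumFin-linear zero .S-* r f = sym (*-zeroʳ r)
sumFin-linear (suc k) .S-* r f = trans
  (cong (r * f zero +_) (sumFin-linear k .S-* r (f ∘ suc)))
  (sym (*-distribˡ-+ r _ _))

sumFin-mono : ∀ k {f g : Fin k → ℚ} → (∀ i → f i ≤ g i) → sumFin k f ≤ sumFin k g
sumFin-mono zero    f≤g = ≤-refl
sumFin-mono (suc k) f≤g = +-mono-≤ (f≤g zero) (sumFin-mono k (f≤g ∘ suc))

0≤sumFin : ∀ k {f : Fin k → ℚ} → (∀ i → 0ℚ ≤ f i) → 0ℚ ≤ sumFin k f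
0≤sumFin k {f} 0≤f = subst (_≤ sumFin k f) (S-0 (sumFin-linear k)) (sumFin-mono k 0≤f)

sumFin-const : ∀ k r → sumFin k (λ _ → r) ≡ ℕ→ℚ k * r
sumFin-const zero    r = sym (*-zeroˡ r)
sumFin-const (suc k) r = begin
  r + sumFin k (λ _ → r)    ≡⟨ cong (r +_) (sumFin-const k r) ⟩
  r + ℕ→ℚ k * r             ≡⟨ solve 2 (λ r k → r :+ k :* r := (con 1ℚ :+ k) :* r) refl r (ℕ→ℚ k) ⟩
  (1ℚ + ℕ→ℚ k) * r          ≡⟨ cong (_* r) (ℕ→ℚ-suc k) ⟨
  ℕ→ℚ (suc k) * r           ∎
  where open ≡-Reasoning

term≤sumFin : ∀ k {f : Fin k → ℚ} → (∀ i → 0ℚ ≤ f i) → ∀ i → f i ≤ sumFin k f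
term≤sumFin (suc k) 0≤f zero    = ≤-+-nonNegʳ (0≤sumFin k (0≤f ∘ suc))
term≤sumFin (suc k) 0≤f (suc i) = ≤-trans (term≤sumFin k (0≤f ∘ suc) i) (≤-+-nonNegˡ (0≤f zero))

sumFin-𝟙 : ∀ k (x : Fin k) (f : Fin k → ℚ) → sumFin k (λ i → 𝟙 (x Fin.≟ i) * f i) ≡ f x
sumFin-𝟙 (suc k) zero f = begin
  1ℚ * f zero + sumFin k (λ i → 𝟙 (zero Fin.≟ suc i) * f (suc i))
    ≡⟨ cong₂ _+_ (*-identityˡ (f zero)) (trans (sumFin-cong k (λ i → *-zeroˡ (f (suc i)))) (S-0 (sumFin-linear k))) ⟩
  f zero + 0ℚ   ≡⟨ +-identityʳ (f zero) ⟩
  f zero        ∎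
  where open ≡-Reasoning
sumFin-𝟙 (suc k) (suc x) f = begin
  0ℚ * f zero + sumFin k (λ i → 𝟙 (suc x Fin.≟ suc i) * f (suc i))
    ≡⟨ cong₂ _+_ (*-zeroˡ (f zero)) (sumFin-cong k (λ i → cong (_* f (suc i)) (𝟙-cong (λ { refl → refl }) (cong suc) (suc x Fin.≟ suc i) (x Fin.≟ i)))) ⟩
  0ℚ + sumFin k (λ i → 𝟙 (x Fin.≟ i) * f (suc i))   ≡⟨ +-identityˡ _ ⟩
  sumFin k (λ i → 𝟙 (x Fin.≟ i) * f (suc i))        ≡⟨ sumFin-𝟙 k x (f ∘ suc) ⟩
  f (suc x)                                         ∎
  where open ≡-Reasoning

sumFin-𝟙ʳ : ∀ k (i : Fin k) (f : Fin k → ℚ) → sumFin k (λ x → f x * 𝟙 (x Fin.≟ i)) ≡ f i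
sumFin-𝟙ʳ k i f = trans
  (sumFin-cong k λ x → trans (*-comm (f x) _) (cong (_* f x) (𝟙-cong sym sym (x Fin.≟ i) (i Fin.≟ x))))
  (sumFin-𝟙 k i f)

sumFuns-linear : ∀ k m → Linear (sumFuns k m)
sumFuns-linear zero m .S-cong f≡g = f≡g _
sumFuns-linear zero m .S-+ f g = refl
sumFuns-linear zero m .S-* r f = refl
sumFuns-linear (suc k) m .S-cong f≡g = sumFin-cong m λ a → sumFuns-linear k m .S-cong λ g → f≡g (consF a g)
sumFuns-linear (suc k) m .S-+ f g = trans
  (sumFin-cong m λ a → sumFuns-linear k m .S-+ _ _)
  (sumFin-linear m .S-+ _ _)
sumFuns-linear (suc k) m .S-* r f = trans
  (sumFin-cong m λ a → sumFuns-linear k m .S-* r _)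
  (sumFin-linear m .S-* r _)

sumFuns-mono : ∀ k m {f g : (Fin k → Fin m) → ℚ} → (∀ s → f s ≤ g s) → sumFuns k m f ≤ sumFuns k m g
sumFuns-mono zero    m f≤g = f≤g _
sumFuns-mono (suc k) m f≤g = sumFin-mono m λ a → sumFuns-mono k m λ s → f≤g (consF a s)

sumFuns-const : ∀ k m r → sumFuns k m (λ _ → r) ≡ ℕ→ℚ (m ℕ.^ k) * r
sumFuns-const zero    m r = sym (*-identityˡ r)
sumFuns-const (suc k) m r = begin
  sumFin m (λ _ → sumFuns k m (λ _ → r))     ≡⟨ sumFin-const m _ ⟩
  ℕ→ℚ m * sumFuns k m (λ _ → r)              ≡⟨ cong (ℕ→ℚ m *_) (sumFuns-const k m r) ⟩
  ℕ→ℚ m * (ℕ→ℚ (m ℕ.^ k) * r)                ≡⟨ *-assoc (ℕ→ℚ m) (ℕ→ℚ (m ℕ.^ k)) r ⟨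
  ℕ→ℚ m * ℕ→ℚ (m ℕ.^ k) * r                  ≡⟨ cong (_* r) (ℕ→ℚ-* m (m ℕ.^ k)) ⟨
  ℕ→ℚ (m ℕ.^ suc k) * r                      ∎
  where open ≡-Reasoning

-- Each of the other coordinates contributes a factor `m`; the factor `ℕ→ℚ m` on the left avoids the
-- exponent `k - 1`.
sumFuns-marginal : ∀ k m (i : Fin k) (f : Fin m → ℚ) →
  ℕ→ℚ m * sumFuns k m (λ s → f (s i)) ≡ ℕ→ℚ (m ℕ.^ k) * sumFin m f
sumFuns-marginal (suc k) m zero f = begin
  ℕ→ℚ m * sumFin m (λ a → sumFuns k m (λ _ → f a))    ≡⟨ cong (ℕ→ℚ m *_) (sumFin-cong m λ a → sumFuns-const k m (f a)) ⟩
  ℕ→ℚ m * sumFin m (λ a → ℕ→ℚ (m ℕ.^ k) * f a)        ≡⟨ cong (ℕ→ℚ m *_) (sumFin-linear m .S-* (ℕ→ℚ (m ℕ.^ k)) f) ⟩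
  ℕ→ℚ m * (ℕ→ℚ (m ℕ.^ k) * sumFin m f)                ≡⟨ *-assoc (ℕ→ℚ m) (ℕ→ℚ (m ℕ.^ k)) _ ⟨
  ℕ→ℚ m * ℕ→ℚ (m ℕ.^ k) * sumFin m f                  ≡⟨ cong (_* sumFin m f) (ℕ→ℚ-* m (m ℕ.^ k)) ⟨
  ℕ→ℚ (m ℕ.^ suc k) * sumFin m f                      ∎
  where open ≡-Reasoning
sumFuns-marginal (suc k) m (suc i) f = begin
  ℕ→ℚ m * sumFin m (λ _ → sumFuns k m (λ s → f (s i)))    ≡⟨ cong (ℕ→ℚ m *_) (sumFin-const m _) ⟩
  ℕ→ℚ m * (ℕ→ℚ m * sumFuns k m (λ s → f (s i)))           ≡⟨ cong (ℕ→ℚ m *_) (sumFuns-marginal k m i f) ⟩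
  ℕ→ℚ m * (ℕ→ℚ (m ℕ.^ k) * sumFin m f)                    ≡⟨ *-assoc (ℕ→ℚ m) (ℕ→ℚ (m ℕ.^ k)) _ ⟨
  ℕ→ℚ m * ℕ→ℚ (m ℕ.^ k) * sumFin m f                      ≡⟨ cong (_* sumFin m f) (ℕ→ℚ-* m (m ℕ.^ k)) ⟨
  ℕ→ℚ (m ℕ.^ suc k) * sumFin m f                          ∎
  where open ≡-Reasoning

-- Independence of two distinct coordinates: `(s i , s j)` takes each pair of values equally often.
sumFuns-marginal₂ : ∀ k m (i j : Fin k) → i ≢ j → (F : Fin m → Fin m → ℚ) →
  ℕ→ℚ m * (ℕ→ℚ m * sumFuns k m (λ s → F (s i) (s j))) ≡
  ℕ→ℚ (m ℕ.^ k) * sumFin m (λ a → sumFin m (F a))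
sumFuns-marginal₂ (suc k) m zero zero i≢j F = ⊥-elim (i≢j refl)
sumFuns-marginal₂ (suc k) m zero (suc j) i≢j F = begin
  ℕ→ℚ m * (ℕ→ℚ m * sumFin m (λ a → sumFuns k m (λ s → F a (s j))))    ≡⟨ cong (ℕ→ℚ m *_) (sumFin-linear m .S-* (ℕ→ℚ m) _) ⟨
  ℕ→ℚ m * sumFin m (λ a → ℕ→ℚ m * sumFuns k m (λ s → F a (s j)))      ≡⟨ cong (ℕ→ℚ m *_) (sumFin-cong m λ a → sumFuns-marginal k m j (F a)) ⟩
  ℕ→ℚ m * sumFin m (λ a → ℕ→ℚ (m ℕ.^ k) * sumFin m (F a))             ≡⟨ cong (ℕ→ℚ m *_) (sumFin-linear m .S-* (ℕ→ℚ (m ℕ.^ k)) _) ⟩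
  ℕ→ℚ m * (ℕ→ℚ (m ℕ.^ k) * sumFin m (λ a → sumFin m (F a)))           ≡⟨ *-assoc (ℕ→ℚ m) (ℕ→ℚ (m ℕ.^ k)) _ ⟨
  ℕ→ℚ m * ℕ→ℚ (m ℕ.^ k) * sumFin m (λ a → sumFin m (F a))             ≡⟨ cong (_* sumFin m (λ a → sumFin m (F a))) (ℕ→ℚ-* m (m ℕ.^ k)) ⟨
  ℕ→ℚ (m ℕ.^ suc k) * sumFin m (λ a → sumFin m (F a))                 ∎
  where open ≡-Reasoning
-- The mirrored case: the arguments of `F` are swapped and the order of the double sum is then
-- restored.
sumFuns-marginal₂ (suc k) m (suc i) zero i≢j F = trans
  (sumFuns-marginal₂ (suc k) m zero (suc i) (i≢j ∘ sym) (λ b a → F a b))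
  (cong (ℕ→ℚ (m ℕ.^ suc k) *_) (S-sumFin (sumFin-linear m) m (λ b a → F a b)))
sumFuns-marginal₂ (suc k) m (suc i) (suc j) i≢j F = begin
  ℕ→ℚ m * (ℕ→ℚ m * sumFin m (λ _ → sumFuns k m (λ s → F (s i) (s j))))    ≡⟨ cong (λ z → ℕ→ℚ m * (ℕ→ℚ m * z)) (sumFin-const m _) ⟩
  ℕ→ℚ m * (ℕ→ℚ m * (ℕ→ℚ m * sumFuns k m (λ s → F (s i) (s j))))           ≡⟨ cong (ℕ→ℚ m *_) (sumFuns-marginal₂ k m i j (i≢j ∘ cong suc) F) ⟩
  ℕ→ℚ m * (ℕ→ℚ (m ℕ.^ k) * sumFin m (λ a → sumFin m (F a)))               ≡⟨ *-assoc (ℕ→ℚ m) (ℕ→ℚ (m ℕ.^ k)) _ ⟨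
  ℕ→ℚ m * ℕ→ℚ (m ℕ.^ k) * sumFin m (λ a → sumFin m (F a))                 ≡⟨ cong (_* sumFin m (λ a → sumFin m (F a))) (ℕ→ℚ-* m (m ℕ.^ k)) ⟨
  ℕ→ℚ (m ℕ.^ suc k) * sumFin m (λ a → sumFin m (F a))                     ∎
  where open ≡-Reasoning

-- Sums over residues

Σ< : ℕ → (ℕ → ℚ) → ℚ
Σ< n f = sumFin n (f ∘ toℕ)

Σ<-cong : ∀ n {f g} → (∀ a → f a ≡ g a) → Σ< n f ≡ Σ< n g
Σ<-cong n f≡g = sumFin-cong n (f≡g ∘ toℕ)

Σ<-+ : ∀ m n f → Σ< (m ℕ.+ n) f ≡ Σ< m f + Σ< n (λ a → f (m ℕ.+ a))
Σ<-+ zero    n f = sym (+-identityˡ _)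
Σ<-+ (suc m) n f = trans (cong (f 0 +_) (Σ<-+ m n (f ∘ suc))) (sym (+-assoc (f 0) _ _))

Σ<-blocks : ∀ m n f → Σ< (m ℕ.* n) f ≡ Σ< m (λ q → Σ< n (λ r → f (q ℕ.* n ℕ.+ r)))
Σ<-blocks zero    n f = refl
Σ<-blocks (suc m) n f = trans (Σ<-+ n (m ℕ.* n) f)
  (cong (Σ< n f +_) (trans (Σ<-blocks m n (λ a → f (n ℕ.+ a)))
    (Σ<-cong m λ q → Σ<-cong n λ r → cong f (sym (ℕ.+-assoc n (q ℕ.* n) r)))))

-- A shift by one drops the first term of a period and appends the term one period later, which is
-- equal to it. `rotate` splits the same `n + 1` terms at either end.
Σ<-shift : ∀ n f → (∀ a → f (n ℕ.+ a) ≡ f a) → ∀ c → Σ< n (λ a → f (a ℕ.+ c)) ≡ Σ< n f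
Σ<-shift n f per zero    = Σ<-cong n λ a → cong f (ℕ.+-identityʳ a)
Σ<-shift n f per (suc c) = begin
  Σ< n (λ a → f (a ℕ.+ suc c))   ≡⟨ Σ<-cong n (λ a → cong f (ℕ.+-suc a c)) ⟩
  Σ< n (λ a → f (suc a ℕ.+ c))   ≡⟨ ∙-cancelˡ (g 0) _ _ rotate ⟩
  Σ< n g                         ≡⟨ Σ<-shift n f per c ⟩
  Σ< n f                         ∎
  where
  open ≡-Reasoning
  g : ℕ → ℚ
  g a = f (a ℕ.+ c)
  rotate : g 0 + Σ< n (g ∘ suc) ≡ g 0 + Σ< n g
  rotate = begin
    Σ< (1 ℕ.+ n) g                     ≡⟨ cong (λ m → Σ< m g) (ℕ.+-comm 1 n) ⟩
    Σ< (n ℕ.+ 1) g                     ≡⟨ Σ<-+ n 1 g ⟩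
    Σ< n g + (g (n ℕ.+ 0) + 0ℚ)        ≡⟨ cong (Σ< n g +_) (+-identityʳ _) ⟩
    Σ< n g + g (n ℕ.+ 0)               ≡⟨ cong (Σ< n g +_) (trans (cong f (ℕ.+-assoc n 0 c)) (per c)) ⟩
    Σ< n g + g 0                       ≡⟨ +-comm (Σ< n g) (g 0) ⟩
    g 0 + Σ< n g                       ∎

Σ<-𝟙 : ∀ {n q} → q ℕ.< n → Σ< n (λ a → 𝟙 (a ℕ.≟ q)) ≡ 1ℚ
Σ<-𝟙 {n} {q} q<n = trans
  (sumFin-cong n λ a → trans
    (𝟙-cong (λ a≡q → toℕ-injective (trans (toℕ-fromℕ< q<n) (sym a≡q)))
            (λ q≡a → trans (cong toℕ (sym q≡a)) (toℕ-fromℕ< q<n))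
            (toℕ a ℕ.≟ q) (fromℕ< q<n Fin.≟ a))
    (sym (*-identityʳ _)))
  (sumFin-𝟙 n (fromℕ< q<n) (λ _ → 1ℚ))

module Residues (B C : ℕ) .{{_ : NonZero B}} .{{_ : NonZero C}} where

  cb : ℕ → ℕ
  cb a = (a / B) % C

  cb<C : ∀ a → cb a ℕ.< C
  cb<C a = m%n<n (a / B) C

  %B-periodic : ∀ h a → (B ℕ.* C ℕ.* h ℕ.+ a) % B ≡ a % B
  %B-periodic h a = %-remove-+ˡ a (∣-trans (m∣m*n C) (m∣m*n h))

  cb-periodic : ∀ h a → cb (B ℕ.* C ℕ.* h ℕ.+ a) ≡ cb a
  cb-periodic h a = begin
    ((B ℕ.* C ℕ.* h ℕ.+ a) / B) % C          ≡⟨ cong (_% C) (+-distrib-/-∣ˡ a (∣-trans (m∣m*n C) (m∣m*n h))) ⟩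
    ((B ℕ.* C ℕ.* h) / B ℕ.+ a / B) % C      ≡⟨ cong (λ z → (z / B ℕ.+ a / B) % C) (ℕ.*-assoc B C h) ⟩
    ((B ℕ.* (C ℕ.* h)) / B ℕ.+ a / B) % C    ≡⟨ cong (λ z → (z ℕ.+ a / B) % C) (m*n/m≡n B (C ℕ.* h)) ⟩
    (C ℕ.* h ℕ.+ a / B) % C                  ≡⟨ %-remove-+ˡ (a / B) (m∣m*n h) ⟩
    (a / B) % C                              ∎
    where
    open ≡-Reasoning
    m*n/m≡n : ∀ m n .{{_ : NonZero m}} → (m ℕ.* n) / m ≡ n
    m*n/m≡n m n = trans (cong (_/ m) (ℕ.*-comm m n)) (m*n/n≡m n m)

  -- Word offset and cache block of a uniform residue are independent and uniform.
  Σ-residues : ∀ (g G : ℕ → ℚ) c →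
    Σ< (B ℕ.* C) (λ a → g ((a ℕ.+ c) % B) * G (cb (a ℕ.+ c))) ≡ Σ< B g * Σ< C G
  Σ-residues g G c = begin
    Σ< (B ℕ.* C) (λ a → F (a ℕ.+ c))                       ≡⟨ Σ<-shift (B ℕ.* C) F F-periodic c ⟩
    Σ< (B ℕ.* C) F                                         ≡⟨ cong (λ n → Σ< n F) (ℕ.*-comm B C) ⟩
    Σ< (C ℕ.* B) F                                         ≡⟨ Σ<-blocks C B F ⟩
    -- The residue `q * B + r` has cache block `q` and word offset `r`, so the two factors separate.
    Σ< C (λ q → Σ< B (λ r → F (q ℕ.* B ℕ.+ r)))
      ≡⟨ sumFin-cong C (λ q → sumFin-cong B λ r → cong₂ (λ u v → g u * G v)
           (trans (%-remove-+ˡ (toℕ r) (n∣m*n (toℕ q))) (m<n⇒m%n≡m (toℕ<n r)))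
           (cb-block (toℕ q) (toℕ r) (toℕ<n q) (toℕ<n r))) ⟩
    Σ< C (λ q → Σ< B (λ r → g r * G q))                    ≡⟨ Σ<-cong C (λ q → S-*ʳ (sumFin-linear B) (G q) (g ∘ toℕ)) ⟩
    Σ< C (λ q → Σ< B g * G q)                              ≡⟨ sumFin-linear C .S-* (Σ< B g) (G ∘ toℕ) ⟩
    Σ< B g * Σ< C G                                        ∎
    where
    open ≡-Reasoning
    F : ℕ → ℚ
    F a = g (a % B) * G (cb a)
    F-periodic : ∀ a → F (B ℕ.* C ℕ.+ a) ≡ F a
    F-periodic a = trans (cong (λ n → F (n ℕ.+ a)) (sym (ℕ.*-identityʳ (B ℕ.* C))))
      (cong₂ (λ u v → g u * G v) (%B-periodic 1 a) (cb-periodic 1 a))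
    cb-block : ∀ q r → q ℕ.< C → r ℕ.< B → cb (q ℕ.* B ℕ.+ r) ≡ q
    cb-block q r q<C r<B = begin
      ((q ℕ.* B ℕ.+ r) / B) % C      ≡⟨ cong (_% C) (+-distrib-/-∣ˡ r (n∣m*n q)) ⟩
      (q ℕ.* B / B ℕ.+ r / B) % C    ≡⟨ cong₂ (λ u v → (u ℕ.+ v) % C) (m*n/n≡m q B) (m<n⇒m/n≡0 r<B) ⟩
      (q ℕ.+ 0) % C                  ≡⟨ cong (_% C) (ℕ.+-identityʳ q) ⟩
      q % C                          ≡⟨ m<n⇒m%n≡m q<C ⟩
      q                              ∎

  Σ-first : Σ< B (λ r → 𝟙 (r ℕ.≟ 0)) ≡ 1ℚ
  Σ-first = Σ<-𝟙 (ℕ.>-nonZero⁻¹ B)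

  Σ-ones : ∀ n → Σ< n (λ _ → 1ℚ) ≡ ℕ→ℚ n
  Σ-ones n = trans (sumFin-const n 1ℚ) (*-identityʳ _)

  Σ-aligned : ∀ c → Σ< (B ℕ.* C) (λ a → 𝟙 ((a ℕ.+ c) % B ℕ.≟ 0)) ≡ ℕ→ℚ C
  Σ-aligned c = begin
    Σ< (B ℕ.* C) (λ a → 𝟙 ((a ℕ.+ c) % B ℕ.≟ 0))          ≡⟨ sumFin-cong (B ℕ.* C) (λ a → sym (*-identityʳ (𝟙 ((toℕ a ℕ.+ c) % B ℕ.≟ 0)))) ⟩
    Σ< (B ℕ.* C) (λ a → 𝟙 ((a ℕ.+ c) % B ℕ.≟ 0) * 1ℚ)     ≡⟨ Σ-residues (λ r → 𝟙 (r ℕ.≟ 0)) (λ _ → 1ℚ) c ⟩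
    Σ< B (λ r → 𝟙 (r ℕ.≟ 0)) * Σ< C (λ _ → 1ℚ)            ≡⟨ cong₂ _*_ Σ-first (Σ-ones C) ⟩
    1ℚ * ℕ→ℚ C                                            ≡⟨ *-identityˡ _ ⟩
    ℕ→ℚ C                                                 ∎
    where open ≡-Reasoning

  Σ-inBlock : ∀ c {q} → q ℕ.< C → Σ< (B ℕ.* C) (λ a → 𝟙 (cb (a ℕ.+ c) ℕ.≟ q)) ≡ ℕ→ℚ B
  Σ-inBlock c {q} q<C = begin
    Σ< (B ℕ.* C) (λ a → 𝟙 (cb (a ℕ.+ c) ℕ.≟ q))           ≡⟨ sumFin-cong (B ℕ.* C) (λ a → sym (*-identityˡ (𝟙 (cb (toℕ a ℕ.+ c) ℕ.≟ q)))) ⟩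
    Σ< (B ℕ.* C) (λ a → 1ℚ * 𝟙 (cb (a ℕ.+ c) ℕ.≟ q))      ≡⟨ Σ-residues (λ _ → 1ℚ) (λ b → 𝟙 (b ℕ.≟ q)) c ⟩
    Σ< B (λ _ → 1ℚ) * Σ< C (λ b → 𝟙 (b ℕ.≟ q))            ≡⟨ cong₂ _*_ (Σ-ones B) (Σ<-𝟙 q<C) ⟩
    ℕ→ℚ B * 1ℚ                                            ≡⟨ *-identityʳ _ ⟩
    ℕ→ℚ B                                                 ∎
    where open ≡-Reasoning

  Σ-startsBlock : ∀ c {q} → q ℕ.< C →
    Σ< (B ℕ.* C) (λ a → 𝟙 ((a ℕ.+ c) % B ℕ.≟ 0) * 𝟙 (cb (a ℕ.+ c) ℕ.≟ q)) ≡ 1ℚ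
  Σ-startsBlock c {q} q<C = trans
    (Σ-residues (λ r → 𝟙 (r ℕ.≟ 0)) (λ b → 𝟙 (b ℕ.≟ q)) c)
    (cong₂ _*_ Σ-first (Σ<-𝟙 q<C))

-- Histories of picks

updF-≡ : ∀ {k} {A : Set} (f : Fin k → A) i a → updF f i a i ≡ a
updF-≡ f zero    a = refl
updF-≡ f (suc i) a = updF-≡ (f ∘ suc) i a

updF-≢ : ∀ {k} {A : Set} (f : Fin k → A) i a {j} → i ≢ j → updF f i a j ≡ f j
updF-≢ f zero    a {zero}  i≢j = ⊥-elim (i≢j refl)
updF-≢ f zero    a {suc j} i≢j = refl
updF-≢ f (suc i) a {zero}  i≢j = refl
updF-≢ f (suc i) a {suc j} i≢j = updF-≢ (f ∘ suc) i a (i≢j ∘ cong suc)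

-- The picks made so far, most recent first.
History : ℕ → Set
History k = List (Fin k)

module _ {k : ℕ} where

  count : History k → Fin k → ℕ
  count []      = λ _ → 0
  count (x ∷ L) = updF (count L) x (suc (count L x))

  -- Picks of j since the last pick of i (0 when i = j).
  gap : History k → Fin k → Fin k → ℕ
  gap [] i j = 0
  gap (x ∷ L) i j with x Fin.≟ i | x Fin.≟ j
  ... | yes _ | _     = 0
  ... | no _  | yes _ = suc (gap L i j)
  ... | no _  | no _  = gap L i j

  gap-diag : ∀ L i → gap L i i ≡ 0
  gap-diag [] i = refl
  gap-diag (x ∷ L) i with x Fin.≟ i
  ... | yes _ = refl
  ... | no _  = gap-diag L i

  firstPick : History k → Fin k → ℚ
  firstPick L x = 𝟙 (count L x ℕ.≟ 0)

  -- The potential that pays for first accesses.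
  unpicked : History k → ℚ
  unpicked L = sumFin k (firstPick L)

  firstPick-step : ∀ L x i → 𝟙 (x Fin.≟ i) * firstPick L i + firstPick (x ∷ L) i ≤ firstPick L i
  firstPick-step L x i with x Fin.≟ i
  ... | yes refl = ≤-reflexive (begin
    1ℚ * firstPick L i + 𝟙 (updF (count L) i (suc (count L i)) i ℕ.≟ 0)
      ≡⟨ cong₂ _+_ (*-identityˡ (firstPick L i)) (cong (λ m → 𝟙 (m ℕ.≟ 0)) (updF-≡ (count L) i _)) ⟩
    firstPick L i + 0ℚ   ≡⟨ +-identityʳ _ ⟩
    firstPick L i        ∎)
    where open ≡-Reasoning
  ... | no x≢i = ≤-reflexive (begin
    0ℚ * firstPick L i + 𝟙 (updF (count L) x (suc (count L x)) i ℕ.≟ 0)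
      ≡⟨ cong₂ _+_ (*-zeroˡ (firstPick L i)) (cong (λ m → 𝟙 (m ℕ.≟ 0)) (updF-≢ (count L) x _ x≢i)) ⟩
    0ℚ + firstPick L i   ≡⟨ +-identityˡ _ ⟩
    firstPick L i        ∎)
    where open ≡-Reasoning

  unpicked-step : ∀ L x → firstPick L x + unpicked (x ∷ L) ≤ unpicked L
  unpicked-step L x = subst (_≤ unpicked L)
    (trans (sumFin-linear k .S-+ _ _) (cong (_+ unpicked (x ∷ L)) (sumFin-𝟙 k x (firstPick L))))
    (sumFin-mono k (firstPick-step L x))

-- For β = B ∸ 1: the number of residues b modulo B C for which m consecutive words starting at b
-- meet a given cache block (when they do not wrap around).
spread : ℚ → ℕ → ℚ
spread β zero    = 0ℚ
spread β (suc m) = β + ℕ→ℚ (suc m)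

-- Expected costs along random picks

module Picks {k : ℕ} (p : Fin k → ℚ) (0≤p : ∀ i → 0ℚ ≤ p i) (Σp≡1 : sumFin k p ≡ 1ℚ) where

  Cost : Set
  Cost = History k → Fin k → ℚ

  -- The recursion of `expMisses`, with the history of picks in place of the cache and the
  -- positions.
  expCost : Cost → ℕ → History k → ℚ
  expCost c zero    L = 0ℚ
  expCost c (suc n) L = sumFin k (λ x → p x * (c L x + expCost c n (x ∷ L)))

  expCost-mono : ∀ {c d : Cost} → (∀ L x → c L x ≤ d L x) → ∀ n L → expCost c n L ≤ expCost d n L
  expCost-mono c≤d zero    L = ≤-refl
  expCost-mono c≤d (suc n) L = sumFin-mono k λ x →
    *-mono-nonNeg (0≤p x) (+-mono-≤ (c≤d L x) (expCost-mono c≤d n (x ∷ L)))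

  -- An exchange of summations, valid because the pick probabilities do not depend on `s`. It serves
  -- both the sum over starts and the sums over pairs of pointers.
  expCost-linear : ∀ {I : Set} {S : (I → ℚ) → ℚ} → Linear S → (c : I → Cost) → ∀ n L →
    S (λ s → expCost (c s) n L) ≡ expCost (λ L x → S (λ s → c s L x)) n L
  expCost-linear lin c zero    L = S-0 lin
  expCost-linear {S = S} lin c (suc n) L = begin
    S (λ s → sumFin k (λ x → p x * (c s L x + expCost (c s) n (x ∷ L))))
      ≡⟨ S-sumFin lin k _ ⟩
    sumFin k (λ x → S (λ s → p x * (c s L x + expCost (c s) n (x ∷ L))))
      ≡⟨ sumFin-cong k (λ x → lin .S-* (p x) _) ⟩
    sumFin k (λ x → p x * S (λ s → c s L x + expCost (c s) n (x ∷ L)))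
      ≡⟨ sumFin-cong k (λ x → cong (p x *_) (lin .S-+ _ _)) ⟩
    sumFin k (λ x → p x * (S (λ s → c s L x) + S (λ s → expCost (c s) n (x ∷ L))))
      ≡⟨ sumFin-cong k (λ x → cong (λ z → p x * (S (λ s → c s L x) + z)) (expCost-linear lin c n (x ∷ L))) ⟩
    sumFin k (λ x → p x * (S (λ s → c s L x) + expCost (λ L x → S (λ s → c s L x)) n (x ∷ L)))
      ∎
    where open ≡-Reasoning

  expCost-* : ∀ r (c : Cost) n L → expCost (λ L x → r * c L x) n L ≡ r * expCost c n L
  expCost-* r c zero    L = sym (*-zeroʳ r)
  expCost-* r c (suc n) L = trans
    (sumFin-cong k λ x → trans
      (cong (λ z → p x * (r * c L x + z)) (expCost-* r c n (x ∷ L)))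
      (solve 4 (λ p r a b → p :* (r :* a :+ r :* b) := r :* (p :* (a :+ b))) refl
        (p x) r (c L x) (expCost c n (x ∷ L))))
    (sumFin-linear k .S-* r _)

  expCost-+ : ∀ (c d : Cost) n L → expCost (λ L x → c L x + d L x) n L ≡ expCost c n L + expCost d n L
  expCost-+ c d zero    L = refl
  expCost-+ c d (suc n) L = trans
    (sumFin-cong k λ x → trans
      (cong (λ z → p x * (c L x + d L x + z)) (expCost-+ c d n (x ∷ L)))
      (solve 5 (λ p a b u v → p :* (a :+ b :+ (u :+ v)) := p :* (a :+ u) :+ p :* (b :+ v)) refl
        (p x) (c L x) (d L x) (expCost c n (x ∷ L)) (expCost d n (x ∷ L))))
    (sumFin-linear k .S-+ _ _)

  mean-+const : ∀ (f : Fin k → ℚ) r → sumFin k (λ x → p x * (f x + r)) ≡ sumFin k (λ x → p x * f x) + r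
  mean-+const f r = begin
    sumFin k (λ x → p x * (f x + r))                            ≡⟨ sumFin-cong k (λ x → *-distribˡ-+ (p x) (f x) r) ⟩
    sumFin k (λ x → p x * f x + p x * r)                        ≡⟨ sumFin-linear k .S-+ _ _ ⟩
    sumFin k (λ x → p x * f x) + sumFin k (λ x → p x * r)       ≡⟨ cong (sumFin k (λ x → p x * f x) +_) (S-*ʳ (sumFin-linear k) r p) ⟩
    sumFin k (λ x → p x * f x) + sumFin k p * r                 ≡⟨ cong (λ z → sumFin k (λ x → p x * f x) + z * r) Σp≡1 ⟩
    sumFin k (λ x → p x * f x) + 1ℚ * r                         ≡⟨ cong (sumFin k (λ x → p x * f x) +_) (*-identityˡ r) ⟩
    sumFin k (λ x → p x * f x) + r                              ∎
    where open ≡-Reasoning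

  -- Amortised analysis: the one-round inequality telescopes, and nonnegativity of `Φ` lets the
  -- final potential be dropped.
  expCost-potential : (c : Cost) (Φ : History k → ℚ) (e : ℚ) → (∀ L → 0ℚ ≤ Φ L) →
    (∀ L → sumFin k (λ x → p x * (c L x + Φ (x ∷ L))) ≤ Φ L + e) →
    ∀ n L → expCost c n L ≤ Φ L + ℕ→ℚ n * e
  expCost-potential c Φ e 0≤Φ step zero L =
    subst (0ℚ ≤_) (sym (trans (cong (Φ L +_) (*-zeroˡ e)) (+-identityʳ (Φ L)))) (0≤Φ L)
  expCost-potential c Φ e 0≤Φ step (suc n) L = begin
    sumFin k (λ x → p x * (c L x + expCost c n (x ∷ L)))
      ≤⟨ sumFin-mono k (λ x → *-mono-nonNeg (0≤p x) (+-monoʳ-≤ (c L x) (expCost-potential c Φ e 0≤Φ step n (x ∷ L)))) ⟩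
    sumFin k (λ x → p x * (c L x + (Φ (x ∷ L) + ℕ→ℚ n * e)))
      ≡⟨ sumFin-cong k (λ x → cong (p x *_) (+-assoc (c L x) (Φ (x ∷ L)) (ℕ→ℚ n * e))) ⟨
    sumFin k (λ x → p x * (c L x + Φ (x ∷ L) + ℕ→ℚ n * e))
      ≡⟨ mean-+const (λ x → c L x + Φ (x ∷ L)) (ℕ→ℚ n * e) ⟩
    sumFin k (λ x → p x * (c L x + Φ (x ∷ L))) + ℕ→ℚ n * e
      ≤⟨ +-monoˡ-≤ (ℕ→ℚ n * e) (step L) ⟩
    Φ L + e + ℕ→ℚ n * e
      ≡⟨ solve 3 (λ Φ e n → Φ :+ e :+ n :* e := Φ :+ (con 1ℚ :+ n) :* e) refl (Φ L) e (ℕ→ℚ n) ⟩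
    Φ L + (1ℚ + ℕ→ℚ n) * e
      ≡⟨ cong (λ z → Φ L + z * e) (ℕ→ℚ-suc n) ⟨
    Φ L + ℕ→ℚ (suc n) * e ∎
    where open ≤-Reasoning

  expCost-const : ∀ r n L → expCost (λ _ _ → r) n L ≡ ℕ→ℚ n * r
  expCost-const r zero    L = sym (*-zeroˡ r)
  expCost-const r (suc n) L = begin
    sumFin k (λ x → p x * (r + expCost (λ _ _ → r) n (x ∷ L)))   ≡⟨ sumFin-cong k (λ x → cong (λ z → p x * (r + z)) (expCost-const r n (x ∷ L))) ⟩
    sumFin k (λ x → p x * (r + ℕ→ℚ n * r))                       ≡⟨ S-*ʳ (sumFin-linear k) _ p ⟩
    sumFin k p * (r + ℕ→ℚ n * r)                                 ≡⟨ cong (_* (r + ℕ→ℚ n * r)) Σp≡1 ⟩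
    1ℚ * (r + ℕ→ℚ n * r)                                         ≡⟨ solve 2 (λ r n → con 1ℚ :* (r :+ n :* r) := (con 1ℚ :+ n) :* r) refl r (ℕ→ℚ n) ⟩
    (1ℚ + ℕ→ℚ n) * r                                             ≡⟨ cong (_* r) (ℕ→ℚ-suc n) ⟨
    ℕ→ℚ (suc n) * r                                              ∎
    where open ≡-Reasoning

  expCost-firstPick : ∀ n → expCost firstPick n [] ≤ ℕ→ℚ k
  expCost-firstPick n = begin
    -- Each pointer has at most one first pick, so `unpicked` pays for all of them: it starts at
    -- `k`, and the allowance per round is 0.
    expCost firstPick n []            ≤⟨ expCost-potential firstPick unpicked 0ℚ (λ L → 0≤sumFin k λ i → 0≤𝟙 (count L i ℕ.≟ 0)) step n [] ⟩
    sumFin k (λ _ → 1ℚ) + ℕ→ℚ n * 0ℚ  ≡⟨ cong₂ _+_ (sumFin-const k 1ℚ) (*-zeroʳ (ℕ→ℚ n)) ⟩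
    ℕ→ℚ k * 1ℚ + 0ℚ                   ≡⟨ trans (+-identityʳ _) (*-identityʳ _) ⟩
    ℕ→ℚ k                             ∎
    where
    open ≤-Reasoning
    step : ∀ L → sumFin k (λ x → p x * (firstPick L x + unpicked (x ∷ L))) ≤ unpicked L + 0ℚ
    step L = begin
      sumFin k (λ x → p x * (firstPick L x + unpicked (x ∷ L)))   ≤⟨ sumFin-mono k (λ x → *-mono-nonNeg (0≤p x) (unpicked-step L x)) ⟩
      sumFin k (λ x → p x * unpicked L)                           ≡⟨ S-*ʳ (sumFin-linear k) (unpicked L) p ⟩
      sumFin k p * unpicked L                                     ≡⟨ cong (_* unpicked L) Σp≡1 ⟩
      1ℚ * unpicked L                                             ≡⟨ trans (*-identityˡ (unpicked L)) (sym (+-identityʳ (unpicked L))) ⟩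
      unpicked L + 0ℚ                                             ∎

  weight : Fin k → Fin k → ℚ
  weight i j = (p i * p j) ÷₀ (p i + p j)

  -- The Markov chain of a pair of pointers

  module Pair (β : ℚ) (0≤β : 0ℚ ≤ β) where

    module _ (i j : Fin k) where

      -- The probability that, of the two pointers, i is picked before j.
      ratio : ℚ
      ratio = p i ÷₀ (p i + p j)

      rate : ℚ
      rate = p j * (β * ratio + 1ℚ)

      0≤ratio : 0ℚ ≤ ratio
      0≤ratio = subst (0ℚ ≤_) (sym (÷₀≡*inv (p i) (p i + p j)))
        (*-nonNeg (0≤p i) (0≤inv _ (+-nonNeg (0≤p i) (0≤p j))))

      -- The convention for division by 0 is consistent here: if `p i + p j` is 0, nonnegativity
      -- forces `p i` to be 0 as well.
      ratio-cancel : (p i + p j) * ratio ≡ p i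
      ratio-cancel with p i + p j ℚ.≟ 0ℚ
      ... | yes s≡0 = trans (*-zeroʳ (p i + p j))
        (≤-antisym (0≤p i) (subst (p i ≤_) s≡0 (≤-+-nonNegʳ (0≤p j))))
      ... | no s≢0 = begin
        s * (p i ℚ.÷ s)      ≡⟨ solve 3 (λ s p t → s :* (p :* t) := p :* (s :* t)) refl s (p i) (ℚ.1/ s) ⟩
        p i * (s * ℚ.1/ s)   ≡⟨ cong (p i *_) (*-inverseʳ s) ⟩
        p i * 1ℚ             ≡⟨ *-identityʳ (p i) ⟩
        p i                  ∎
        where
        open ≡-Reasoning
        s = p i + p j
        instance _ = ℚ.≢-nonZero s≢0

      -- Splits the rate into the symmetric term of the bound and a term `p j` that sums to 1 over
      -- `j`.
      rate-weight : rate ≡ β * weight i j + p j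
      rate-weight = begin
        p j * (β * (p i ÷₀ s) + 1ℚ)      ≡⟨ cong (λ z → p j * (β * z + 1ℚ)) (÷₀≡*inv (p i) s) ⟩
        p j * (β * (p i * inv s) + 1ℚ)   ≡⟨ solve 4 (λ pi pj b v → pj :* (b :* (pi :* v) :+ con 1ℚ) := b :* ((pi :* pj) :* v) :+ pj) refl (p i) (p j) β (inv s) ⟩
        β * ((p i * p j) * inv s) + p j  ≡⟨ cong (λ z → β * z + p j) (÷₀≡*inv (p i * p j) s) ⟨
        β * weight i j + p j             ∎
        where
        open ≡-Reasoning
        s = p i + p j

      -- The part of the cost of a pick of `i` that is due to `j`, before scaling by `κ`.
      conflict : Cost
      conflict L x = 𝟙 (x Fin.≟ i) * spread β (gap L i j)

      -- Chosen so that cost plus drift of the chain gap L i j equals rate in every state.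
      pot : ℕ → ℚ
      pot zero    = 0ℚ
      pot (suc m) = β * ratio + ℕ→ℚ (suc m)

      0≤pot : ∀ m → 0ℚ ≤ pot m
      0≤pot zero    = ≤-refl
      0≤pot (suc m) = +-nonNeg (*-nonNeg 0≤β 0≤ratio) (0≤ℕ→ℚ (suc m))

      pot-mono : ∀ m → pot m ≤ pot (suc m)
      pot-mono zero    = 0≤pot 1
      pot-mono (suc m) = +-monoʳ-≤ (β * ratio) (subst (ℕ→ℚ (suc m) ≤_) (sym (ℕ→ℚ-suc (suc m))) (≤-+-nonNegˡ 0≤1))

      -- At a positive gap, a pick of `i` costs `β * (1 - ratio)` more than the potential it
      -- releases, and a pick of `j` raises the potential by 1; `ratio-cancel` turns the weighted
      -- sum into `rate`. At gap 0 only the jump to `pot 1` contributes.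
      drift : ∀ m → p i * (spread β m - pot m) + p j * (pot (suc m) - pot m) ≡ rate
      drift zero = solve 3 (λ pi pj a → pi :* (con 0ℚ :- con 0ℚ) :+ pj :* ((a :+ con 1ℚ) :- con 0ℚ) := pj :* (a :+ con 1ℚ)) refl (p i) (p j) (β * ratio)
      drift (suc m) = begin
        p i * (β + M - (β * ratio + M)) + p j * (β * ratio + ℕ→ℚ (2 ℕ.+ m) - (β * ratio + M))
          ≡⟨ cong (λ z → p i * (β + M - (β * ratio + M)) + p j * (β * ratio + z - (β * ratio + M))) (ℕ→ℚ-suc (suc m)) ⟩
        p i * (β + M - (β * ratio + M)) + p j * (β * ratio + (1ℚ + M) - (β * ratio + M))
          ≡⟨ solve 5 (λ pi pj b r M → pi :* (b :+ M :- (b :* r :+ M)) :+ pj :* (b :* r :+ (con 1ℚ :+ M) :- (b :* r :+ M))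
               := b :* pi :+ (pj :* (b :* r :+ con 1ℚ) :- b :* ((pi :+ pj) :* r))) refl (p i) (p j) β ratio M ⟩
        β * p i + (rate - β * ((p i + p j) * ratio))
          ≡⟨ cong (λ z → β * p i + (rate - β * z)) ratio-cancel ⟩
        β * p i + (rate - β * p i)
          ≡⟨ solve 2 (λ a b → a :+ (b :- a) := b) refl (β * p i) rate ⟩
        rate ∎
        where
        open ≡-Reasoning
        M = ℕ→ℚ (suc m)

      -- The indicators make the right side linear, ready for averaging. Equality holds except when
      -- `x` is both `i` and `j`: the right side then also counts the move to `suc m`, which is
      -- nonnegative by `pot-mono`.
      conflict-step : ∀ L x → let m = gap L i j in
        conflict L x + pot (gap (x ∷ L) i j) ≤
        (𝟙 (x Fin.≟ i) * (spread β m - pot m) + 𝟙 (x Fin.≟ j) * (pot (suc m) - pot m)) + pot m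
      conflict-step L x with x Fin.≟ i | x Fin.≟ j
      ... | yes _ | yes _ = begin
        1ℚ * w + 0ℚ                                   ≤⟨ ≤-+-nonNegʳ 0≤g-f ⟩
        1ℚ * w + 0ℚ + (g - f)                         ≡⟨ solve 3 (λ w f g → con 1ℚ :* w :+ con 0ℚ :+ (g :- f) := con 1ℚ :* (w :- f) :+ con 1ℚ :* (g :- f) :+ f) refl w f g ⟩
        1ℚ * (w - f) + 1ℚ * (g - f) + f               ∎
        where
        open ≤-Reasoning
        w = spread β (gap L i j)
        f = pot (gap L i j)
        g = pot (suc (gap L i j))
        0≤g-f : 0ℚ ≤ g - f
        0≤g-f = subst (_≤ g - f) (+-inverseʳ f) (+-monoˡ-≤ (ℚ.- f) (pot-mono (gap L i j)))
      ... | yes _ | no _ = ≤-reflexive (solve 3 (λ w f g → con 1ℚ :* w :+ con 0ℚ := con 1ℚ :* (w :- f) :+ con 0ℚ :* (g :- f) :+ f) refl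
          (spread β (gap L i j)) (pot (gap L i j)) (pot (suc (gap L i j))))
      ... | no _ | yes _ = ≤-reflexive (solve 3 (λ w f g → con 0ℚ :* w :+ g := con 0ℚ :* (w :- f) :+ con 1ℚ :* (g :- f) :+ f) refl
          (spread β (gap L i j)) (pot (gap L i j)) (pot (suc (gap L i j))))
      ... | no _ | no _ = ≤-reflexive (solve 3 (λ w f g → con 0ℚ :* w :+ f := con 0ℚ :* (w :- f) :+ con 0ℚ :* (g :- f) :+ f) refl
          (spread β (gap L i j)) (pot (gap L i j)) (pot (suc (gap L i j))))

      mean-conflict : ∀ L →
        sumFin k (λ x → p x * (conflict L x + pot (gap (x ∷ L) i j))) ≤ pot (gap L i j) + rate
      mean-conflict L = begin
        sumFin k (λ x → p x * (conflict L x + pot (gap (x ∷ L) i j)))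
          ≤⟨ sumFin-mono k (λ x → *-mono-nonNeg (0≤p x) (conflict-step L x)) ⟩
        sumFin k (λ x → p x * ((𝟙 (x Fin.≟ i) * u + 𝟙 (x Fin.≟ j) * v) + pot m))
          ≡⟨ mean-+const (λ x → 𝟙 (x Fin.≟ i) * u + 𝟙 (x Fin.≟ j) * v) (pot m) ⟩
        sumFin k (λ x → p x * (𝟙 (x Fin.≟ i) * u + 𝟙 (x Fin.≟ j) * v)) + pot m
          ≡⟨ cong (_+ pot m) (sumFin-cong k λ x → solve 5 (λ p a u b v → p :* (a :* u :+ b :* v) := p :* a :* u :+ p :* b :* v) refl
               (p x) (𝟙 (x Fin.≟ i)) u (𝟙 (x Fin.≟ j)) v) ⟩
        sumFin k (λ x → p x * 𝟙 (x Fin.≟ i) * u + p x * 𝟙 (x Fin.≟ j) * v) + pot m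
          ≡⟨ cong (_+ pot m) (sumFin-linear k .S-+ _ _) ⟩
        sumFin k (λ x → p x * 𝟙 (x Fin.≟ i) * u) + sumFin k (λ x → p x * 𝟙 (x Fin.≟ j) * v) + pot m
          ≡⟨ cong (_+ pot m) (cong₂ _+_ (weigh i u) (weigh j v)) ⟩
        p i * u + p j * v + pot m
          ≡⟨ cong (_+ pot m) (drift m) ⟩
        rate + pot m
          ≡⟨ +-comm rate (pot m) ⟩
        pot m + rate ∎
        where
        open ≤-Reasoning
        m = gap L i j
        u = spread β m - pot m
        v = pot (suc m) - pot m
        weigh : ∀ i u → sumFin k (λ x → p x * 𝟙 (x Fin.≟ i) * u) ≡ p i * u
        weigh i u = trans (S-*ʳ (sumFin-linear k) u (λ x → p x * 𝟙 (x Fin.≟ i))) (cong (_* u) (sumFin-𝟙ʳ k i p))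

      expCost-conflict : ∀ n → expCost conflict n [] ≤ ℕ→ℚ n * rate
      -- The empty history has gap 0, hence potential 0.
      expCost-conflict n = subst (expCost conflict n [] ≤_) (+-identityˡ _)
        (expCost-potential conflict (λ L → pot (gap L i j)) rate (λ L → 0≤pot (gap L i j)) mean-conflict n [])

    conflicts : Cost
    conflicts L x = sumFin k (λ j → spread β (gap L x j))

    -- By linearity each ordered pair is handled with its own chain, so the joint law of the gaps
    -- never enters.
    expCost-conflicts : ∀ n → expCost conflicts n [] ≤
      ℕ→ℚ n * (β * sumFin k (λ i → sumFin k (λ j → weight i j)) + ℕ→ℚ k)
    expCost-conflicts n = begin
      expCost conflicts n []
        ≤⟨ expCost-mono (λ L x → ≤-reflexive (regroup L x)) n [] ⟩
      expCost (λ L x → sumFin k (λ i → sumFin k (λ j → conflict i j L x))) n []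
        ≡⟨ expCost-linear (sumFin-linear k) (λ i L x → sumFin k (λ j → conflict i j L x)) n [] ⟨
      sumFin k (λ i → expCost (λ L x → sumFin k (λ j → conflict i j L x)) n [])
        ≡⟨ sumFin-cong k (λ i → expCost-linear (sumFin-linear k) (conflict i) n []) ⟨
      sumFin k (λ i → sumFin k (λ j → expCost (conflict i j) n []))
        ≤⟨ sumFin-mono k (λ i → sumFin-mono k (λ j → expCost-conflict i j n)) ⟩
      sumFin k (λ i → sumFin k (λ j → ℕ→ℚ n * rate i j))
        ≡⟨ sumFin-cong k (λ i → sumFin-linear k .S-* (ℕ→ℚ n) (rate i)) ⟩
      sumFin k (λ i → ℕ→ℚ n * sumFin k (rate i))
        ≡⟨ sumFin-linear k .S-* (ℕ→ℚ n) _ ⟩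
      ℕ→ℚ n * sumFin k (λ i → sumFin k (rate i))
        -- The terms `p j` of the rates sum to 1 for each `i`, hence to `k` in all.
        ≡⟨ cong (ℕ→ℚ n *_) (trans (sumFin-cong k total) (trans (sumFin-linear k .S-+ _ _)
             (cong₂ _+_ (sumFin-linear k .S-* β _) (trans (sumFin-const k 1ℚ) (*-identityʳ _))))) ⟩
      ℕ→ℚ n * (β * sumFin k (λ i → sumFin k (weight i)) + ℕ→ℚ k) ∎
      where
      open ≤-Reasoning
      regroup : ∀ L x → conflicts L x ≡ sumFin k (λ i → sumFin k (λ j → conflict i j L x))
      regroup L x = sym (trans (sumFin-cong k (λ i → sumFin-linear k .S-* (𝟙 (x Fin.≟ i)) _)) (sumFin-𝟙 k x _))
      total : ∀ i → sumFin k (rate i) ≡ β * sumFin k (weight i) + 1ℚ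
      total i = trans (sumFin-cong k (rate-weight i)) (trans (sumFin-linear k .S-+ _ _)
        (cong₂ _+_ (sumFin-linear k .S-* β _) Σp≡1))

-- Touches and misses

-- Either `suc (a % B)` is below `B` and adding 1 causes no carry, or it equals `B` and `suc a` is a
-- multiple of `B`.
suc-/ : ∀ a B .{{_ : NonZero B}} → suc a % B ≢ 0 → suc a / B ≡ a / B
suc-/ a B sa%B≢0 with ℕ.m≤n⇒m<n∨m≡n (m%n<n a B)
... | inj₁ sr<B = begin
  suc a / B                            ≡⟨ cong (λ z → suc z / B) (m≡m%n+[m/n]*n a B) ⟩
  (suc (a % B) ℕ.+ a / B ℕ.* B) / B    ≡⟨ +-distrib-/-∣ʳ (suc (a % B)) (n∣m*n (a / B)) ⟩
  suc (a % B) / B ℕ.+ a / B ℕ.* B / B  ≡⟨ cong₂ ℕ._+_ (m<n⇒m/n≡0 sr<B) (m*n/n≡m (a / B) B) ⟩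
  a / B                                ∎
  where open ≡-Reasoning
... | inj₂ sr≡B = ⊥-elim (sa%B≢0 (begin
  suc a % B                            ≡⟨ cong (λ z → suc z % B) (m≡m%n+[m/n]*n a B) ⟩
  (suc (a % B) ℕ.+ a / B ℕ.* B) % B    ≡⟨ cong (λ z → (z ℕ.+ a / B ℕ.* B) % B) sr≡B ⟩
  (suc (a / B) ℕ.* B) % B              ≡⟨ m*n%n≡0 (suc (a / B)) B ⟩
  0                                    ∎))
  where open ≡-Reasoning

gap≤count : ∀ {k} L (i j : Fin k) → gap L i j ℕ.≤ count L j
gap≤count [] i j = ℕ.z≤n
gap≤count (x ∷ L) i j with x Fin.≟ i | x Fin.≟ j
... | yes _ | _ = ℕ.z≤n
... | no _ | yes refl = subst (suc (gap L i j) ℕ.≤_) (sym (updF-≡ (count L) j _)) (ℕ.s≤s (gap≤count L i j))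
... | no _ | no x≢j = subst (gap L i j ℕ.≤_) (sym (updF-≢ (count L) x _ x≢j)) (gap≤count L i j)

module Touches (B C : ℕ) .{{_ : NonZero B}} .{{_ : NonZero C}} (k : ℕ) where

  open Residues B C

  β : ℚ
  β = ℕ→ℚ (B ℕ.∸ 1)

  0≤β : 0ℚ ≤ β
  0≤β = 0≤ℕ→ℚ (B ℕ.∸ 1)

  β+1≡B : β + 1ℚ ≡ ℕ→ℚ B
  β+1≡B = trans (sym (ℕ→ℚ-+ (B ℕ.∸ 1) 1)) (cong ℕ→ℚ (ℕ.m∸n+n≡m (ℕ.>-nonZero⁻¹ B)))

  -- Here `m` is the gap before the access. The first word since the last pick of `i` counts
  -- wherever it lies in its block; a later word counts only at the start of a block.
  newTouch : (m a q : ℕ) → ℚ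
  newTouch zero    a q = 𝟙 (cb a ℕ.≟ q)
  newTouch (suc _) a q = 𝟙 (a % B ℕ.≟ 0) * 𝟙 (cb a ℕ.≟ q)

  -- How often D_j, started at residue b, has entered cache block q since the last pick of i.
  -- Words inside a memory block are not counted again, so this is at most the number of
  -- accesses to q, but it is positive as soon as there is one.
  touches : History k → (i j : Fin k) → (q b : ℕ) → ℚ
  touches [] i j q b = 0ℚ
  touches (x ∷ L) i j q b with x Fin.≟ i | x Fin.≟ j
  ... | yes _ | _     = 0ℚ
  ... | no _  | yes _ = touches L i j q b + newTouch (gap L i j) (b ℕ.+ count L j) q
  ... | no _  | no _  = touches L i j q b

  0≤newTouch : ∀ m a q → 0ℚ ≤ newTouch m a q
  0≤newTouch zero    a q = 0≤𝟙 (cb a ℕ.≟ q)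
  0≤newTouch (suc _) a q = *-nonNeg (0≤𝟙 (a % B ℕ.≟ 0)) (0≤𝟙 (cb a ℕ.≟ q))

  0≤touches : ∀ L i j q b → 0ℚ ≤ touches L i j q b
  0≤touches [] i j q b = ≤-refl
  0≤touches (x ∷ L) i j q b with x Fin.≟ i | x Fin.≟ j
  ... | yes _ | _     = ≤-refl
  ... | no _  | yes _ = +-nonNeg (0≤touches L i j q b) (0≤newTouch (gap L i j) _ q)
  ... | no _  | no _  = 0≤touches L i j q b

  touches-diag : ∀ L i q b → touches L i i q b ≡ 0ℚ
  touches-diag [] i q b = refl
  touches-diag (x ∷ L) i q b with x Fin.≟ i
  ... | yes _ = refl
  ... | no _  = touches-diag L i q b

  touches-mono : ∀ x L {i} j q b → x ≢ i → touches L i j q b ≤ touches (x ∷ L) i j q b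
  touches-mono x L {i} j q b x≢i with x Fin.≟ i | x Fin.≟ j
  ... | yes x≡i | _   = ⊥-elim (x≢i x≡i)
  ... | no _ | yes _  = ≤-+-nonNegʳ (0≤newTouch (gap L i j) _ q)
  ... | no _ | no _   = ≤-refl

  -- Mutual induction with `1≤touches`. An access to `q` adds no touch only if it lies inside a
  -- block and is not the first since the last pick of `i`. The preceding word of that block was
  -- then accessed since that pick too, and the induction descends to it.
  1≤newTouch : ∀ L i j q b → cb (b ℕ.+ count L j) ≡ q →
    1ℚ ≤ touches L i j q b + newTouch (gap L i j) (b ℕ.+ count L j) q
  1≤touches : ∀ L i j q b c → gap L i j ≢ 0 → count L j ≡ suc c → cb (b ℕ.+ c) ≡ q →
    1ℚ ≤ touches L i j q b

  1≤newTouch L i j q b hit with gap L i j in gap≡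
  ... | zero  = subst (_≤ touches L i j q b + 𝟙 (cb (b ℕ.+ count L j) ℕ.≟ q)) (𝟙-true (cb (b ℕ.+ count L j) ℕ.≟ q) hit) (≤-+-nonNegˡ (0≤touches L i j q b))
  ... | suc m with (b ℕ.+ count L j) % B ℕ.≟ 0
  ...   | yes _ = subst (_≤ touches L i j q b + 1ℚ * 𝟙 (cb (b ℕ.+ count L j) ℕ.≟ q))
    (trans (*-identityˡ _) (𝟙-true (cb (b ℕ.+ count L j) ℕ.≟ q) hit)) (≤-+-nonNegˡ (0≤touches L i j q b))
  ...   | no %≢0 = ≤-trans earlier (≤-+-nonNegʳ (*-nonNeg ≤-refl (0≤𝟙 (cb (b ℕ.+ count L j) ℕ.≟ q))))
    where
    earlier : 1ℚ ≤ touches L i j q b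
    earlier with count L j in count≡
    -- A positive gap means that `j` has been picked, so its count cannot be 0.
    ... | zero  = ⊥-elim (ℕ.1+n≰n (ℕ.≤-trans (ℕ.s≤s ℕ.z≤n) (subst₂ ℕ._≤_ gap≡ count≡ (gap≤count L i j))))
    ... | suc c = 1≤touches L i j q b c (λ gap≡0 → ℕ.1+n≢0 (trans (sym gap≡) gap≡0)) count≡
      (trans (cong (_% C) (sym (suc-/ (b ℕ.+ c) B (subst (λ z → z % B ≢ 0) (ℕ.+-suc b c) %≢0))))
             (trans (cong cb (sym (ℕ.+-suc b c))) hit))

  1≤touches [] i j q b c gap≢0 count≡ hit = ⊥-elim (gap≢0 refl)
  1≤touches (x ∷ L) i j q b c gap≢0 count≡ hit with x Fin.≟ i | x Fin.≟ j
  ... | yes _ | _ = ⊥-elim (gap≢0 refl)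
  ... | no _ | yes refl = 1≤newTouch L i j q b
    (subst (λ z → cb (b ℕ.+ z) ≡ q) (ℕ.suc-injective (trans (sym count≡) (updF-≡ (count L) j _))) hit)
  ... | no _ | no x≢j = 1≤touches L i j q b c gap≢0 (trans (sym (updF-≢ (count L) x _ x≢j)) count≡) hit

  1≤touches-pick : ∀ x L {i} q b → x ≢ i → cb (b ℕ.+ count L x) ≡ q → 1ℚ ≤ touches (x ∷ L) i x q b
  1≤touches-pick x L {i} q b x≢i hit with x Fin.≟ i | x Fin.≟ x
  ... | yes x≡i | _   = ⊥-elim (x≢i x≡i)
  ... | no _ | yes _  = 1≤newTouch L i x q b hit
  ... | no _ | no x≢x = ⊥-elim (x≢x refl)

  -- The first word lies in cache block `q` for `B` residues, that is `β + 1`; each later word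
  -- starts a memory block of `q` for exactly one residue.
  spread-step : ∀ m b {q} → q ℕ.< C →
    spread β m + Σ< (B ℕ.* C) (λ a → newTouch m (a ℕ.+ b) q) ≡ spread β (suc m)
  spread-step zero b q<C = trans (+-identityˡ _) (trans (Σ-inBlock b q<C) (sym β+1≡B))
  spread-step (suc m) b q<C = begin
    β + ℕ→ℚ (suc m) + Σ< (B ℕ.* C) (λ a → newTouch (suc m) (a ℕ.+ b) _)   ≡⟨ cong (β + ℕ→ℚ (suc m) +_) (Σ-startsBlock b q<C) ⟩
    β + ℕ→ℚ (suc m) + 1ℚ    ≡⟨ solve 2 (λ β m → β :+ m :+ con 1ℚ := β :+ (con 1ℚ :+ m)) refl β (ℕ→ℚ (suc m)) ⟩
    β + (1ℚ + ℕ→ℚ (suc m))  ≡⟨ cong (β +_) (ℕ→ℚ-suc (suc m)) ⟨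
    β + ℕ→ℚ (2 ℕ.+ m)       ∎
    where open ≡-Reasoning

  Σ-touches : ∀ L i j {q} → q ℕ.< C → Σ< (B ℕ.* C) (touches L i j q) ≡ spread β (gap L i j)
  Σ-touches [] i j q<C = S-0 (sumFin-linear (B ℕ.* C))
  Σ-touches (x ∷ L) i j {q} q<C with x Fin.≟ i | x Fin.≟ j
  ... | yes _ | _ = S-0 (sumFin-linear (B ℕ.* C))
  ... | no _ | yes _ = trans
    (sumFin-linear (B ℕ.* C) .S-+ _ _)
    (trans (cong (_+ Σ< (B ℕ.* C) (λ a → newTouch (gap L i j) (a ℕ.+ count L j) q)) (Σ-touches L i j q<C))
           (spread-step (gap L i j) (count L j) q<C))
  ... | no _ | no _ = Σ-touches L i j q<C

  -- The cost of a pick of x: a first access, the start of a memory block, or an eviction.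
  missCost : (Fin k → ℕ) → History k → Fin k → ℚ
  missCost σ L x = firstPick L x + (𝟙 (a % B ℕ.≟ 0) +
    sumFin k (λ j → (1ℚ - 𝟙 (a % B ℕ.≟ 0)) * touches L x j (cb a) (σ j)))
    where a = σ x ℕ.+ count L x

  0≤1-𝟙 : ∀ {P : Set} (P? : Dec P) → 0ℚ ≤ 1ℚ - 𝟙 P?
  0≤1-𝟙 (yes _) = ≤-refl
  0≤1-𝟙 (no _)  = 0≤1

  -- Simulation of the cache by touches

  module Simulation (hi σ : Fin k → ℕ) where

    base : Fin k → ℕ
    base i = B ℕ.* C ℕ.* hi i ℕ.+ σ i

    -- A multiple of `B * C` does not move the cache block. Together with `base-%` this lets misses
    -- be charged through residues alone, whatever the high parts are.
    cb-base : ∀ i t → cb (base i ℕ.+ t) ≡ cb (σ i ℕ.+ t)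
    cb-base i t = trans (cong cb (ℕ.+-assoc (B ℕ.* C ℕ.* hi i) (σ i) t)) (cb-periodic (hi i) (σ i ℕ.+ t))

    base-% : ∀ i t → (base i ℕ.+ t) % B ≡ (σ i ℕ.+ t) % B
    base-% i t = trans (cong (_% B) (ℕ.+-assoc (B ℕ.* C ℕ.* hi i) (σ i) t)) (%B-periodic (hi i) (σ i ℕ.+ t))

    same-block : ∀ i c → (σ i ℕ.+ suc c) % B ≢ 0 → (base i ℕ.+ suc c) / B ≡ (base i ℕ.+ c) / B
    same-block i c ¬aligned = trans (cong (_/ B) (ℕ.+-suc (base i) c)) (suc-/ (base i ℕ.+ c) B
      λ e → ¬aligned (trans (sym (base-% i (suc c))) (trans (cong (_% B) (ℕ.+-suc (base i) c)) e)))

    -- The block last used by D_i is still cached unless another pointer has entered its cache block.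
    Consistent : Cache → History k → Set
    Consistent cache L = ∀ i c → count L i ≡ suc c →
      cache (cb (base i ℕ.+ c)) ≡ just ((base i ℕ.+ c) / B) ⊎
      ∃ λ j → 1ℚ ≤ touches L i j (cb (base i ℕ.+ c)) (σ j)

    module _ (cache : Cache) (a : ℕ) where

      updℕ-≡ : ∀ (f : Cache) q {v} → updℕ f q v q ≡ v
      updℕ-≡ f q with q ℕ.≟ q
      ... | yes _  = refl
      ... | no q≢q = ⊥-elim (q≢q refl)

      updℕ-≢ : ∀ (f : Cache) q {v r} → q ≢ r → updℕ f q v r ≡ f r
      updℕ-≢ f q {r = r} q≢r with q ℕ.≟ r
      ... | yes q≡r = ⊥-elim (q≢r q≡r)
      ... | no _    = refl

      access-loaded : proj₂ (access B C cache a) (cb a) ≡ just (a / B)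
      access-loaded with cache ((a / B) % C) in eq
      ... | nothing = updℕ-≡ cache (cb a)
      ... | just b with b ℕ.≟ (a / B)
      ...   | yes refl = eq
      ...   | no _     = updℕ-≡ cache (cb a)

      access-other : ∀ {q} → cb a ≢ q → proj₂ (access B C cache a) q ≡ cache q
      access-other a≢q with cache ((a / B) % C)
      ... | nothing = updℕ-≢ cache (cb a) a≢q
      ... | just b with b ℕ.≟ (a / B)
      ...   | yes _ = refl
      ...   | no _  = updℕ-≢ cache (cb a) a≢q

      access-≤1 : ℕ→ℚ (proj₁ (access B C cache a)) ≤ 1ℚ
      access-≤1 with cache ((a / B) % C)
      ... | nothing = ≤-refl
      ... | just b with b ℕ.≟ (a / B)
      ...   | yes _ = 0≤1
      ...   | no _  = ≤-refl

      access-hit : cache (cb a) ≡ just (a / B) → proj₁ (access B C cache a) ≡ 0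
      access-hit hit with cache ((a / B) % C)
      ... | just b with b ℕ.≟ (a / B)
      ...   | yes _  = refl
      ...   | no b≢  = ⊥-elim (b≢ (just-injective hit))

    -- A pick of `i` leaves its own block loaded. Any other pick goes either to a different cache
    -- block, whose access leaves the entry alone, or to the same one, which is a touch by `x`.
    -- Touches persist until `i` is picked.
    Consistent-step : ∀ cache L x → Consistent cache L →
      Consistent (proj₂ (access B C cache (base x ℕ.+ count L x))) (x ∷ L)
    Consistent-step cache L x ok i c count≡ = by-pick (x Fin.≟ i)
      where
      cache′ : Cache
      cache′ = proj₂ (access B C cache (base x ℕ.+ count L x))
      Goal : Set
      Goal = cache′ (cb (base i ℕ.+ c)) ≡ just ((base i ℕ.+ c) / B) ⊎
        ∃ λ j → 1ℚ ≤ touches (x ∷ L) i j (cb (base i ℕ.+ c)) (σ j)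
      by-pick : Dec (x ≡ i) → Goal
      by-pick (yes refl) = inj₁ (subst (λ c → cache′ (cb (base x ℕ.+ c)) ≡ just ((base x ℕ.+ c) / B))
        (ℕ.suc-injective (trans (sym (updF-≡ (count L) x _)) count≡))
        (access-loaded cache (base x ℕ.+ count L x)))
      by-pick (no x≢i) with ok i c (trans (sym (updF-≢ (count L) x _ x≢i)) count≡)
      ... | inj₂ (j , 1≤t) = inj₂ (j , ≤-trans 1≤t (touches-mono x L j _ (σ j) x≢i))
      ... | inj₁ cached = by-block (cb (base x ℕ.+ count L x) ℕ.≟ cb (base i ℕ.+ c))
        where
        by-block : Dec (cb (base x ℕ.+ count L x) ≡ cb (base i ℕ.+ c)) → Goal
        by-block (yes same) = inj₂ (x , 1≤touches-pick x L _ (σ x) x≢i (trans (sym (cb-base x (count L x))) same))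
        by-block (no other) = inj₁ (trans (access-other cache (base x ℕ.+ count L x) other) cached)

    -- A first access is paid by `firstPick`, a block start by its indicator. Any other access stays
    -- in the block of the preceding word, where `Consistent` yields either a hit or a pointer whose
    -- touches already amount to 1.
    miss≤missCost : ∀ cache L x → Consistent cache L →
      ℕ→ℚ (proj₁ (access B C cache (base x ℕ.+ count L x))) ≤ missCost σ L x
    miss≤missCost cache L x ok = helper (count L x) refl
      where
      open ≤-Reasoning
      miss : ℕ → ℚ
      miss c = ℕ→ℚ (proj₁ (access B C cache (base x ℕ.+ c)))
      touch : ℕ → Fin k → ℚ
      touch c j = touches L x j (cb (σ x ℕ.+ c)) (σ j)
      inner : ℕ → Fin k → ℚ
      inner c j = (1ℚ - 𝟙 ((σ x ℕ.+ c) % B ℕ.≟ 0)) * touch c j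
      0≤inner : ∀ c j → 0ℚ ≤ inner c j
      0≤inner c j = *-nonNeg (0≤1-𝟙 ((σ x ℕ.+ c) % B ℕ.≟ 0)) (0≤touches L x j _ (σ j))
      later : ℕ → ℚ
      later c = 𝟙 ((σ x ℕ.+ c) % B ℕ.≟ 0) + sumFin k (inner c)
      0≤later : ∀ c → 0ℚ ≤ later c
      0≤later c = +-nonNeg (0≤𝟙 ((σ x ℕ.+ c) % B ℕ.≟ 0)) (0≤sumFin k (0≤inner c))
      miss≤later : ∀ c → count L x ≡ suc c → miss (suc c) ≤ later (suc c)
      miss≤later c count≡ with (σ x ℕ.+ suc c) % B ℕ.≟ 0 in aligned?
      ... | yes aligned = ≤-trans (access-≤1 cache (base x ℕ.+ suc c))
        (≤-+-nonNegʳ (0≤sumFin k λ j → *-nonNeg {1ℚ - 1ℚ} ≤-refl (0≤touches L x j _ (σ j))))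
      ... | no ¬aligned with ok x c count≡
      ...   | inj₁ cached = ≤-trans (≤-reflexive (cong ℕ→ℚ (access-hit cache (base x ℕ.+ suc c) still-cached)))
        (+-nonNeg ≤-refl (0≤sumFin k λ j → *-nonNeg {1ℚ - 0ℚ} 0≤1 (0≤touches L x j _ (σ j))))
        where
        still-cached : cache (cb (base x ℕ.+ suc c)) ≡ just ((base x ℕ.+ suc c) / B)
        still-cached = subst (λ m → cache (m % C) ≡ just m) (sym (same-block x c ¬aligned)) cached
      ...   | inj₂ (j , 1≤t) = begin
        miss (suc c)                                        ≤⟨ access-≤1 cache (base x ℕ.+ suc c) ⟩
        1ℚ                                                  ≤⟨ 1≤t ⟩
        touches L x j (cb (base x ℕ.+ c)) (σ j)             ≡⟨ cong (λ q → touches L x j q (σ j)) (trans (cong (_% C) (sym (same-block x c ¬aligned))) (cb-base x (suc c))) ⟩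
        touch (suc c) j                                     ≡⟨ *-identityˡ _ ⟨
        1ℚ * touch (suc c) j                                ≤⟨ term≤sumFin k (λ j → *-nonNeg {1ℚ - 0ℚ} 0≤1 (0≤touches L x j _ (σ j))) j ⟩
        sumFin k (λ j → (1ℚ - 0ℚ) * touch (suc c) j)        ≡⟨ +-identityˡ _ ⟨
        0ℚ + sumFin k (λ j → (1ℚ - 0ℚ) * touch (suc c) j)   ∎
      helper : ∀ c → count L x ≡ c → miss c ≤ 𝟙 (c ℕ.≟ 0) + later c
      helper zero    count≡ = ≤-trans (access-≤1 cache (base x ℕ.+ 0)) (≤-+-nonNegʳ (0≤later 0))
      helper (suc c) count≡ = ≤-trans (miss≤later c count≡) (≤-+-nonNegˡ ≤-refl)

-- Averaging over the starts

module Average (B C k : ℕ) .{{_ : NonZero B}} .{{_ : NonZero C}} where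

  open Residues B C
  open Touches B C k

  N : ℕ
  N = B ℕ.* C

  instance
    N-nonZero : NonZero N
    N-nonZero = ℕ.m*n≢0 B C

    BN-nonZero : NonZero (B ℕ.* B ℕ.* C)
    BN-nonZero = ℕ.m*n≢0 (B ℕ.* B) C {{ℕ.m*n≢0 B B}}

  offsets : (Fin k → Fin N) → Fin k → ℕ
  offsets s i = toℕ (s i)

  starts : ℚ
  starts = ℕ→ℚ (N ℕ.^ k)

  0≤starts : 0ℚ ≤ starts
  0≤starts = 0≤ℕ→ℚ (N ℕ.^ k)

  D : ℚ
  D = ℕ→ℚ (B ℕ.* B ℕ.* C)

  -- The probability (B ∸ 1) / B of being inside a block times the probability 1 / (B C) of a
  -- given residue.
  κ : ℚ
  κ = β * inv D

  0≤κ : 0ℚ ≤ κ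
  0≤κ = *-nonNeg 0≤β (0≤inv D (0≤ℕ→ℚ (B ℕ.* B ℕ.* C)))

  N≢0 : ℕ→ℚ N ≢ 0ℚ
  N≢0 = ℕ→ℚ-nonZero N

  -- Exactly `C` of the `B * C` residues put the word at the start of a block.
  Σ-starts-aligned : ∀ i c →
    sumFuns k N (λ s → 𝟙 ((offsets s i ℕ.+ c) % B ℕ.≟ 0)) ≡ starts * inv (ℕ→ℚ B)
  Σ-starts-aligned i c = *-cancelˡ-≡ (ℕ→ℚ N) N≢0 (begin
    ℕ→ℚ N * sumFuns k N (λ s → 𝟙 ((offsets s i ℕ.+ c) % B ℕ.≟ 0))
      ≡⟨ sumFuns-marginal k N i (λ a → 𝟙 ((toℕ a ℕ.+ c) % B ℕ.≟ 0)) ⟩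
    starts * Σ< N (λ a → 𝟙 ((a ℕ.+ c) % B ℕ.≟ 0))
      ≡⟨ cong (starts *_) (Σ-aligned c) ⟩
    starts * ℕ→ℚ C
      ≡⟨ solve 2 (λ P C → P :* C := P :* C :* con 1ℚ) refl starts (ℕ→ℚ C) ⟩
    starts * ℕ→ℚ C * 1ℚ
      ≡⟨ cong (starts * ℕ→ℚ C *_) (inv-inverseʳ (ℕ→ℚ B) (ℕ→ℚ-nonZero B)) ⟨
    starts * ℕ→ℚ C * (ℕ→ℚ B * inv (ℕ→ℚ B))
      ≡⟨ solve 4 (λ P C B I → P :* C :* (B :* I) := B :* C :* (P :* I)) refl starts (ℕ→ℚ C) (ℕ→ℚ B) (inv (ℕ→ℚ B)) ⟩
    ℕ→ℚ B * ℕ→ℚ C * (starts * inv (ℕ→ℚ B))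
      ≡⟨ cong (_* (starts * inv (ℕ→ℚ B))) (ℕ→ℚ-* B C) ⟨
    ℕ→ℚ N * (starts * inv (ℕ→ℚ B)) ∎)
    where open ≡-Reasoning

  Σ-unaligned : ∀ c → Σ< N (λ a → 1ℚ - 𝟙 ((a ℕ.+ c) % B ℕ.≟ 0)) ≡ ℕ→ℚ C * β
  Σ-unaligned c = begin
    Σ< N (λ a → 1ℚ - 𝟙 ((a ℕ.+ c) % B ℕ.≟ 0))
      ≡⟨ sumFin-cong N (λ a → solve 1 (λ u → con 1ℚ :- u := con 1ℚ :+ con (ℚ.- 1ℚ) :* u) refl (𝟙 ((toℕ a ℕ.+ c) % B ℕ.≟ 0))) ⟩
    Σ< N (λ a → 1ℚ + ℚ.- 1ℚ * 𝟙 ((a ℕ.+ c) % B ℕ.≟ 0))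
      ≡⟨ sumFin-linear N .S-+ _ _ ⟩
    Σ< N (λ _ → 1ℚ) + Σ< N (λ a → ℚ.- 1ℚ * 𝟙 ((a ℕ.+ c) % B ℕ.≟ 0))
      ≡⟨ cong₂ _+_ (trans (Σ-ones N) (ℕ→ℚ-* B C)) (trans (sumFin-linear N .S-* (ℚ.- 1ℚ) _) (cong (ℚ.- 1ℚ *_) (Σ-aligned c))) ⟩
    ℕ→ℚ B * ℕ→ℚ C + ℚ.- 1ℚ * ℕ→ℚ C
      ≡⟨ cong (λ z → z * ℕ→ℚ C + ℚ.- 1ℚ * ℕ→ℚ C) β+1≡B ⟨
    (β + 1ℚ) * ℕ→ℚ C + ℚ.- 1ℚ * ℕ→ℚ C
      ≡⟨ solve 2 (λ b C → (b :+ con 1ℚ) :* C :+ con (ℚ.- 1ℚ) :* C := C :* b) refl β (ℕ→ℚ C) ⟩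
    ℕ→ℚ C * β ∎
    where open ≡-Reasoning

  -- Matches `κ` with the count in `Σ-unaligned`: both give `C * (B - 1)`.
  NNκ : ℕ→ℚ N * (ℕ→ℚ N * κ) ≡ ℕ→ℚ C * β
  NNκ = begin
    ℕ→ℚ N * (ℕ→ℚ N * (β * inv D))              ≡⟨ cong (λ z → z * (z * (β * inv D))) (ℕ→ℚ-* B C) ⟩
    B′ * C′ * (B′ * C′ * (β * inv D))          ≡⟨ solve 4 (λ B C b I → B :* C :* (B :* C :* (b :* I)) := C :* b :* (B :* B :* C :* I)) refl B′ C′ β (inv D) ⟩
    C′ * β * (B′ * B′ * C′ * inv D)            ≡⟨ cong (λ z → C′ * β * (z * inv D)) (trans (ℕ→ℚ-* (B ℕ.* B) C) (cong (_* C′) (ℕ→ℚ-* B B))) ⟨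
    C′ * β * (D * inv D)                       ≡⟨ cong (C′ * β *_) (inv-inverseʳ D (ℕ→ℚ-nonZero (B ℕ.* B ℕ.* C))) ⟩
    C′ * β * 1ℚ                                ≡⟨ *-identityʳ _ ⟩
    C′ * β                                     ∎
    where
    open ≡-Reasoning
    B′ = ℕ→ℚ B
    C′ = ℕ→ℚ C

  -- Fixing the start of `x` fixes the cache block and leaves the start of `j` uniform. By
  -- `Σ-touches` the sum over the latter is the same for every cache block, so the factor for being
  -- inside a block separates. A pointer never touches against itself.
  Σ-starts-touches : ∀ L x j →
    let a = λ s → offsets s x ℕ.+ count L x in
    sumFuns k N (λ s → (1ℚ - 𝟙 (a s % B ℕ.≟ 0)) * touches L x j (cb (a s)) (offsets s j)) ≡
    starts * (κ * spread β (gap L x j))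
  Σ-starts-touches L x j with x Fin.≟ j
  ... | yes refl = begin
    sumFuns k N (λ s → (1ℚ - 𝟙 ((offsets s x ℕ.+ count L x) % B ℕ.≟ 0)) * touches L x x (cb (offsets s x ℕ.+ count L x)) (offsets s x))
      ≡⟨ sumFuns-linear k N .S-cong (λ s → trans (cong ((1ℚ - 𝟙 ((offsets s x ℕ.+ count L x) % B ℕ.≟ 0)) *_) (touches-diag L x _ (offsets s x)))
           (*-zeroʳ (1ℚ - 𝟙 ((offsets s x ℕ.+ count L x) % B ℕ.≟ 0)))) ⟩
    sumFuns k N (λ _ → 0ℚ)                ≡⟨ S-0 (sumFuns-linear k N) ⟩
    0ℚ                                    ≡⟨ solve 2 (λ P κ → con 0ℚ := P :* (κ :* con 0ℚ)) refl starts κ ⟩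
    starts * (κ * 0ℚ)                     ≡⟨ cong (λ m → starts * (κ * spread β m)) (gap-diag L x) ⟨
    starts * (κ * spread β (gap L x x))   ∎
    where open ≡-Reasoning
  -- One factor `N` is cancelled for each of the two independent starts.
  ... | no x≢j = *-cancelˡ-≡ (ℕ→ℚ N) N≢0 (*-cancelˡ-≡ (ℕ→ℚ N) N≢0 (begin
    ℕ→ℚ N * (ℕ→ℚ N * sumFuns k N (λ s → F (s x) (s j)))
      ≡⟨ sumFuns-marginal₂ k N x j x≢j F ⟩
    starts * sumFin N (λ a → sumFin N (F a))
      ≡⟨ cong (starts *_) (sumFin-cong N λ a → trans (sumFin-linear N .S-* (u a) _)
           (cong (u a *_) (Σ-touches L x j (cb<C (toℕ a ℕ.+ count L x))))) ⟩
    starts * sumFin N (λ a → u a * w)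
      ≡⟨ cong (starts *_) (S-*ʳ (sumFin-linear N) w u) ⟩
    starts * (sumFin N u * w)
      ≡⟨ cong (λ z → starts * (z * w)) (trans (Σ-unaligned (count L x)) (sym NNκ)) ⟩
    starts * (ℕ→ℚ N * (ℕ→ℚ N * κ) * w)
      ≡⟨ solve 4 (λ P N κ w → P :* (N :* (N :* κ) :* w) := N :* (N :* (P :* (κ :* w)))) refl starts (ℕ→ℚ N) κ w ⟩
    ℕ→ℚ N * (ℕ→ℚ N * (starts * (κ * w))) ∎))
    where
    open ≡-Reasoning
    w = spread β (gap L x j)
    u : Fin N → ℚ
    u a = 1ℚ - 𝟙 ((toℕ a ℕ.+ count L x) % B ℕ.≟ 0)
    F : Fin N → Fin N → ℚ
    F a b = u a * touches L x j (cb (toℕ a ℕ.+ count L x)) (toℕ b)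

  -- From the process to the bound

  module Process (p : Fin k → ℚ) (0≤p : ∀ i → 0ℚ ≤ p i) (Σp≡1 : sumFin k p ≡ 1ℚ) where

    open Picks p 0≤p Σp≡1
    open Pair β 0≤β

    meanCost : Cost
    meanCost L x = firstPick L x + (inv (ℕ→ℚ B) + κ * conflicts L x)

    Σ-missCost : ∀ L x → sumFuns k N (λ s → missCost (offsets s) L x) ≡ starts * meanCost L x
    Σ-missCost L x = begin
      sumFuns k N (λ s → firstPick L x + (al s + sumFin k (λ j → cf s j)))
        ≡⟨ lin .S-+ _ _ ⟩
      sumFuns k N (λ _ → firstPick L x) + sumFuns k N (λ s → al s + sumFin k (λ j → cf s j))
        ≡⟨ cong₂ _+_ (sumFuns-const k N (firstPick L x)) (lin .S-+ _ _) ⟩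
      starts * firstPick L x + (sumFuns k N al + sumFuns k N (λ s → sumFin k (cf s)))
        ≡⟨ cong (starts * firstPick L x +_) (cong₂ _+_ (Σ-starts-aligned x (count L x)) conflicts≡) ⟩
      starts * firstPick L x + (starts * inv (ℕ→ℚ B) + starts * (κ * conflicts L x))
        ≡⟨ solve 4 (λ P f i c → P :* f :+ (P :* i :+ P :* c) := P :* (f :+ (i :+ c))) refl starts (firstPick L x) (inv (ℕ→ℚ B)) (κ * conflicts L x) ⟩
      starts * meanCost L x ∎
      where
      open ≡-Reasoning
      lin = sumFuns-linear k N
      al : (Fin k → Fin N) → ℚ
      al s = 𝟙 ((offsets s x ℕ.+ count L x) % B ℕ.≟ 0)
      cf : (Fin k → Fin N) → Fin k → ℚ
      cf s j = (1ℚ - al s) * touches L x j (cb (offsets s x ℕ.+ count L x)) (offsets s j)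
      conflicts≡ : sumFuns k N (λ s → sumFin k (cf s)) ≡ starts * (κ * conflicts L x)
      conflicts≡ = trans (S-sumFin lin k cf) (trans (sumFin-cong k (Σ-starts-touches L x))
        (trans (sumFin-linear k .S-* starts _) (cong (starts *_) (sumFin-linear k .S-* κ _))))

    -- A comparison for each fixed start. With positions `count L`, a pick of `x` gives
    -- `count (x ∷ L)` by definition, so both recursions follow the same history.
    expMisses≤ : ∀ hi σ n cache L → Simulation.Consistent hi σ cache L →
      expMisses B C k p (Simulation.base hi σ) n cache (count L) ≤ expCost (missCost σ) n L
    expMisses≤ hi σ zero    cache L ok = ≤-refl
    expMisses≤ hi σ (suc n) cache L ok = sumFin-mono k λ x → *-mono-nonNeg (0≤p x)
      (+-mono-≤ (miss≤missCost cache L x ok) (expMisses≤ hi σ n _ (x ∷ L) (Consistent-step cache L x ok)))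
      where open Simulation hi σ

    Σweights : ℚ
    Σweights = sumFin k (λ i → sumFin k (λ j → weight i j))

    bound≡ : ∀ n → bound B C k p n ≡
      ℕ→ℚ k + (ℕ→ℚ n * inv (ℕ→ℚ B) + κ * (ℕ→ℚ n * (β * Σweights + ℕ→ℚ k)))
    bound≡ n = begin
      ℕ→ℚ k + ℕ→ℚ n * (inv (ℕ→ℚ B) + (ℕ→ℚ (k ℕ.* b) ÷₀ D) + (ℕ→ℚ (b ℕ.* b) ÷₀ D) * Σweights)
        ≡⟨ cong₂ (λ u v → ℕ→ℚ k + ℕ→ℚ n * (inv (ℕ→ℚ B) + u + v * Σweights))
             (trans (÷₀≡*inv _ D) (cong (_* inv D) (ℕ→ℚ-* k b)))
             (trans (÷₀≡*inv _ D) (cong (_* inv D) (ℕ→ℚ-* b b))) ⟩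
      ℕ→ℚ k + ℕ→ℚ n * (inv (ℕ→ℚ B) + ℕ→ℚ k * β * inv D + β * β * inv D * Σweights)
        -- The last two terms of the bound share the factor `κ`.
        ≡⟨ solve 6 (λ k n i b d w → k :+ n :* (i :+ k :* b :* d :+ b :* b :* d :* w) := k :+ (n :* i :+ b :* d :* (n :* (b :* w :+ k)))) refl
             (ℕ→ℚ k) (ℕ→ℚ n) (inv (ℕ→ℚ B)) β (inv D) Σweights ⟩
      ℕ→ℚ k + (ℕ→ℚ n * inv (ℕ→ℚ B) + κ * (ℕ→ℚ n * (β * Σweights + ℕ→ℚ k))) ∎
      where
      open ≡-Reasoning
      b = B ℕ.∸ 1

    expCost-meanCost : ∀ n → expCost meanCost n [] ≤ bound B C k p n
    expCost-meanCost n = begin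
      expCost meanCost n []
        ≡⟨ trans (expCost-+ firstPick _ n []) (cong (expCost firstPick n [] +_)
             (trans (expCost-+ (λ _ _ → inv (ℕ→ℚ B)) _ n []) (cong₂ _+_ (expCost-const (inv (ℕ→ℚ B)) n []) (expCost-* κ conflicts n [])))) ⟩
      expCost firstPick n [] + (ℕ→ℚ n * inv (ℕ→ℚ B) + κ * expCost conflicts n [])
        ≤⟨ +-mono-≤ (expCost-firstPick n) (+-monoʳ-≤ (ℕ→ℚ n * inv (ℕ→ℚ B)) (*-mono-nonNeg 0≤κ (expCost-conflicts n))) ⟩
      ℕ→ℚ k + (ℕ→ℚ n * inv (ℕ→ℚ B) + κ * (ℕ→ℚ n * (β * Σweights + ℕ→ℚ k)))
        ≡⟨ bound≡ n ⟨
      bound B C k p n ∎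
      where open ≤-Reasoning

    ΣexpMisses≤ : ∀ h n →
      sumFuns k N (λ s → expMisses B C k p (startAddr B C k h s) n emptyCache (λ _ → 0)) ≤
      starts * bound B C k p n
    ΣexpMisses≤ h n = begin
      sumFuns k N (λ s → expMisses B C k p (startAddr B C k h s) n emptyCache (λ _ → 0))
        -- Nothing has been picked yet, so the empty cache is vacuously `Consistent`.
        ≤⟨ sumFuns-mono k N (λ s → expMisses≤ (h s) (offsets s) n emptyCache [] (λ i c ())) ⟩
      sumFuns k N (λ s → expCost (missCost (offsets s)) n [])
        -- The sum over starts moves inside, so that each history is averaged separately.
        ≡⟨ expCost-linear (sumFuns-linear k N) (λ s → missCost (offsets s)) n [] ⟩
      expCost (λ L x → sumFuns k N (λ s → missCost (offsets s) L x)) n []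
        ≤⟨ expCost-mono (λ L x → ≤-reflexive (Σ-missCost L x)) n [] ⟩
      expCost (λ L x → starts * meanCost L x) n []
        ≡⟨ expCost-* starts meanCost n [] ⟩
      starts * expCost meanCost n []
        ≤⟨ *-mono-nonNeg 0≤starts (expCost-meanCost n) ⟩
      starts * bound B C k p n ∎
      where open ≤-Reasoning

    expectedMisses≤ : ∀ h n → expectedMisses B C k p h n ≤ bound B C k p n
    expectedMisses≤ h n = begin
      S ÷₀ starts                               ≡⟨ ÷₀≡*inv S starts ⟩
      S * inv starts                            ≡⟨ *-comm S (inv starts) ⟩
      inv starts * S                            ≤⟨ *-mono-nonNeg (0≤inv starts 0≤starts) (ΣexpMisses≤ h n) ⟩
      inv starts * (starts * bound B C k p n)   ≡⟨ solve 3 (λ i P b → i :* (P :* b) := P :* i :* b) refl (inv starts) starts (bound B C k p n) ⟩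
      starts * inv starts * bound B C k p n     ≡⟨ cong (_* bound B C k p n) (inv-inverseʳ starts (ℕ→ℚ-nonZero (N ℕ.^ k) {{ℕ.m^n≢0 N k}})) ⟩
      1ℚ * bound B C k p n                      ≡⟨ *-identityˡ _ ⟩
      bound B C k p n                           ∎
      where
      open ≤-Reasoning
      S = sumFuns k N (λ s → expMisses B C k p (startAddr B C k h s) n emptyCache (λ _ → 0))

theorem6 : (B C k : ℕ) → .{{_ : NonZero B}} → .{{_ : NonZero C}} →
    2 ℕ.≤ k → k ℕ.≤ C ℕ.* B → B ∣ k →
    (p : Fin k → ℚ) → (∀ i → 0ℚ ℚ.≤ p i) → sumFin k p ≡ 1ℚ →
    (n : ℕ) → (h : (Fin k → Fin (B ℕ.* C)) → Fin k → ℕ) →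
    (∀ s i j → i ≢ j → ∀ t t′ → t ℕ.< n → t′ ℕ.< n →
    (startAddr B C k h s i ℕ.+ t) / B ≢ (startAddr B C k h s j ℕ.+ t′) / B) →
    expectedMisses B C k p h n ℚ.≤ bound B C k p n
theorem6 B C k _ _ _ p 0≤p Σp≡1 n h _ = Average.Process.expectedMisses≤ B C k p 0≤p Σp≡1 h n
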